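{- Let $H:\mathbb N\to\mathbb N$ be defined by $H(0)=0$ and $H(i)=i-H(H(H(i-1)))$ for $i\ge1$, and let $S=S(0)S(1)S(2)\cdots$ be the infinite word where $S(i)$ is the number of $k\ge0$ with $H(k)=i$ (so $S=12112212112\cdots$, with values in $\{1,2\}$). Then the critical exponent of $S$ is $(\alpha^2+\alpha+5)/3\approx2.8711567558605$, where $\alpha$ is the real root of $X^3=X^2+1$.
   Context: A finite word $w=w[0..n]$ has period $p$ if $w[0..n-p]=w[p..n]$; the exponent of $w$ is $|w|$ divided by its smallest period. The critical exponent of an infinite word is the supremum of the exponents of its nonempty factors. -}

module Defs where

open import Data.Nat using (ℕ; zero; suc; _+_; _*_; _<_; _≤_; _^_)
open import Data.Nat.Properties using (_≟_)
open import Data.Product using (_×_)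
open import Relation.Nullary using (¬_; yes; no)
open import Relation.Binary.PropositionalEquality using (_≡_)

countBelow : (ℕ → ℕ) → ℕ → ℕ → ℕ
countBelow f i zero = zero
countBelow f i (suc N) with f N ≟ i
... | yes _ = suc (countBelow f i N)
... | no  _ = countBelow f i N

HasPeriod : (ℕ → ℕ) → ℕ → ℕ → ℕ → Set
HasPeriod x i n p =
  (1 ≤ p) × (p ≤ n) × (∀ j → j + p < n → x (i + j) ≡ x (i + j + p))

MinPeriod : (ℕ → ℕ) → ℕ → ℕ → ℕ → Set
MinPeriod x i n p = HasPeriod x i n p × (∀ q → q < p → ¬ HasPeriod x i n q)

-- The constant c = (α²+α+5)/3, α the real root of X³ = X² + 1, is the unique
-- real root of 3X³ − 17X² + 30X − 17 (its minimal polynomial), which is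
-- negative exactly to the left of c.  For naturals a, b with b > 0:
--   a / b ≤ c  iff  3a³ − 17a²b + 30ab² − 17b³ ≤ 0
--   a / b < c  iff  3a³ − 17a²b + 30ab² − 17b³ < 0
RatAtMostC : ℕ → ℕ → Set
RatAtMostC a b = 3 * a ^ 3 + 30 * a * b ^ 2 ≤ 17 * a ^ 2 * b + 17 * b ^ 3

RatBelowC : ℕ → ℕ → Set
RatBelowC a b = 3 * a ^ 3 + 30 * a * b ^ 2 < 17 * a ^ 2 * b + 17 * b ^ 3

{-# OPTIONS --safe #-}

-- Put K = H ∘ H and P i = i + K i. Then H (P i) = i and H (P i + 1) = i + 1, so S (i+1) = 1 + K (i+1) − K i, and
-- with R = P ∘ P the word S is, after its first letter, the coding a ↦ 2, b ↦ 1, c ↦ 1 of the fixed point y of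
-- a ↦ acb, b ↦ ac, c ↦ a, the blocks of y starting at the positions R u.
--
-- Each image has a single a, at its start, so a repetition of y desubstitutes to one further left in y. Hence every
-- repetition lies inside one obtained from two distinct letters of y by iterating the morphism, each step prolonging
-- the match by the common prefix of the images. Exponents above 43/15 arise only in two families: period a Narayana
-- number N(k), and excess over the period N(k) + N(k−2) + N(k−4) + …; passing to S adds at most one letter.
--
-- For consecutive Narayana numbers x, y, z the three quadrics vanishing at (1 : α : α²) are o(x), and the cubic
-- form of c at the family members lies in the ideal they generate, plus a term of order x² of known sign.
module Submission where

open import Defs

-- The cubic form of the critical exponent and its sign at Narayana numbers.

module Cubic where

  open import Data.Nat as ℕ using (ℕ; suc; z≤n)
  import Data.Nat.Properties as ℕₚ
  open import Data.Integer as ℤ using (ℤ; +_; _+_; _*_; _-_; +≤+)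
  import Data.Integer.Properties as ℤₚ
  open import Data.Integer.Tactic.RingSolver using (solve-∀)
  open import Relation.Nullary using (yes; no)
  open import Relation.Binary.PropositionalEquality using (_≡_; sym; trans; cong; cong₂; subst; subst₂)

  -- The inequalities of this module are certificates: an identity checked by the ring solver writes
  -- the target, up to a positive factor, as a sum of products of nonnegative terms, assembled with
  -- `⊕` and `⊗`.
  NonNeg : ℤ → Set
  NonNeg i = + 0 ℤ.≤ i

  infixl 6 _⊕_
  infixl 7 _⊗_

  _⊕_ : ∀ {i j} → NonNeg i → NonNeg j → NonNeg (i + j)
  _⊕_ = ℤₚ.+-mono-≤

  _⊗_ : ∀ {i j} → NonNeg i → NonNeg j → NonNeg (i * j)
  _⊗_ {+ m} {+ n} _ _ = subst NonNeg (ℤₚ.pos-* m n) (+≤+ z≤n)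

  sq≥0 : ∀ i → NonNeg (i * i)
  sq≥0 (+ n) = _⊗_ {+ n} {+ n} (+≤+ z≤n) (+≤+ z≤n)
  sq≥0 ℤ.-[1+ n ] = +≤+ z≤n

  nat : ∀ n → NonNeg (+ n)
  nat n = +≤+ z≤n

  by : ∀ {i j} → i ≡ j → NonNeg j → NonNeg i
  by eq = subst NonNeg (sym eq)

  cancel-pos : ∀ n {i} → NonNeg (+ suc n * i) → NonNeg i
  cancel-pos n {i} p =
    ℤₚ.*-cancelˡ-≤-pos (+ 0) i (+ suc n) (subst (ℤ._≤ + suc n * i) (sym (ℤₚ.*-zeroʳ (+ suc n))) p)

  -- Minus the homogenised minimal polynomial of the critical exponent.
  cubicGap : ℤ → ℤ → ℤ
  cubicGap a b = + 17 * (a * a) * b + + 17 * (b * b * b) - (+ 3 * (a * a * a) + + 30 * a * (b * b))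

  private
    pos-² : ∀ n → + (n ℕ.^ 2) ≡ + n * + n
    pos-² n = trans (cong (λ k → + (n ℕ.* k)) (ℕₚ.*-identityʳ n)) (ℤₚ.pos-* n n)

    pos-³ : ∀ n → + (n ℕ.^ 3) ≡ + n * + n * + n
    pos-³ n = trans (ℤₚ.pos-* n (n ℕ.^ 2)) (trans (cong (λ i → + n * i) (pos-² n)) (sym (ℤₚ.*-assoc (+ n) (+ n) (+ n))))

    pos-cubicLHS : ∀ a b → + (3 ℕ.* a ℕ.^ 3 ℕ.+ 30 ℕ.* a ℕ.* b ℕ.^ 2)
                         ≡ + 3 * (+ a * + a * + a) + + 30 * + a * (+ b * + b)
    pos-cubicLHS a b = trans (ℤₚ.pos-+ (3 ℕ.* a ℕ.^ 3) (30 ℕ.* a ℕ.* b ℕ.^ 2)) (cong₂ _+_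
      (trans (ℤₚ.pos-* 3 (a ℕ.^ 3)) (cong (λ i → + 3 * i) (pos-³ a)))
      (trans (ℤₚ.pos-* (30 ℕ.* a) (b ℕ.^ 2)) (cong₂ _*_ (ℤₚ.pos-* 30 a) (pos-² b))))

    pos-cubicRHS : ∀ a b → + (17 ℕ.* a ℕ.^ 2 ℕ.* b ℕ.+ 17 ℕ.* b ℕ.^ 3)
                         ≡ + 17 * (+ a * + a) * + b + + 17 * (+ b * + b * + b)
    pos-cubicRHS a b = trans (ℤₚ.pos-+ (17 ℕ.* a ℕ.^ 2 ℕ.* b) (17 ℕ.* b ℕ.^ 3)) (cong₂ _+_
      (trans (ℤₚ.pos-* (17 ℕ.* a ℕ.^ 2) b) (cong (λ i → i * + b) (trans (ℤₚ.pos-* 17 (a ℕ.^ 2)) (cong (λ i → + 17 * i) (pos-² a)))))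
      (trans (ℤₚ.pos-* 17 (b ℕ.^ 3)) (cong (λ i → + 17 * i) (pos-³ b))))

  cubicGap≥0⇒RatAtMostC : ∀ a b → NonNeg (cubicGap (+ a) (+ b)) → RatAtMostC a b
  cubicGap≥0⇒RatAtMostC a b gap = ℤₚ.drop‿+≤+
    (subst₂ ℤ._≤_ (sym (pos-cubicLHS a b)) (sym (pos-cubicRHS a b)) (ℤₚ.0≤i-j⇒j≤i gap))

  RatBelowC⇒cubicGap≥1 : ∀ a b → RatBelowC a b → NonNeg (cubicGap (+ a) (+ b) - + 1)
  RatBelowC⇒cubicGap≥1 a b below = by (rearrange (+ 3 * (+ a * + a * + a) + + 30 * + a * (+ b * + b)) (+ 17 * (+ a * + a) * + b + + 17 * (+ b * + b * + b))) (ℤₚ.i≤j⇒0≤j-i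
    (subst₂ ℤ._≤_ (trans (ℤₚ.pos-+ 1 _) (cong (λ i → + 1 + i) (pos-cubicLHS a b))) (pos-cubicRHS a b) (+≤+ below)))
    where
    rearrange : ∀ l r → r - l - + 1 ≡ r - (+ 1 + l)
    rearrange = solve-∀

  -- 43/15 < c, and the tangent of the cubic at its local maximum near 7/5 stays negative up to 18/5.
  15n≤43p⇒RatAtMostC : ∀ n p → 15 ℕ.* n ℕ.≤ 43 ℕ.* p → RatAtMostC n p
  15n≤43p⇒RatAtMostC n p le = cubicGap≥0⇒RatAtMostC n p (cancel-pos 124
    (by (identity (+ n) (+ p)) (h ⊗ sq≥0 (+ 5 * + n - + 7 * + p) ⊕ sq≥0 (+ p) ⊗ h′)))
    where
    identity : ∀ n p → + 125 * (+ 17 * (n * n) * p + + 17 * (p * p * p) - (+ 3 * (n * n * n) + + 30 * n * (p * p)))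
      ≡ (+ 43 * p - + 15 * n) * ((+ 5 * n - + 7 * p) * (+ 5 * n - + 7 * p)) + p * p * (+ 18 * p - + 5 * n)
    identity = solve-∀
    h : NonNeg (+ 43 * + p - + 15 * + n)
    h = ℤₚ.i≤j⇒0≤j-i (subst₂ ℤ._≤_ (ℤₚ.pos-* 15 n) (ℤₚ.pos-* 43 p) (+≤+ le))
    third : ∀ n p → + 3 * (+ 18 * p - + 5 * n) ≡ + 43 * p - + 15 * n + + 11 * p
    third = solve-∀
    h′ : NonNeg (+ 18 * + p - + 5 * + n)
    h′ = cancel-pos 2 (by (third (+ n) (+ p)) (h ⊕ nat 11 ⊗ nat p))

  -- With 3 n = 8 p + v, nine times the cubic gap of n / p is deficit p v.
  deficit : ℤ → ℤ → ℤ
  deficit p v = + 9 * (p * p * p) - v * (+ 10 * (p * p) + + 7 * p * v + v * v)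

  -- `deficit (+ x)` decreases on nonnegative arguments, and nine times the gap of n / x is its
  -- value at u = 3 n - 8 x ≤ v. The case split serves only to make u nonnegative: 43/15 exceeds
  -- 8/3.
  deficit≥0⇒RatAtMostC : ∀ x n v → NonNeg v → NonNeg (deficit (+ x) v) →
    NonNeg (+ 8 * + x + v - + 3 * + n) → RatAtMostC n x
  deficit≥0⇒RatAtMostC x n v v≥0 gap le with 15 ℕ.* n ℕ.≤? 43 ℕ.* x
  ... | yes le′ = 15n≤43p⇒RatAtMostC n x le′
  ... | no nle = cubicGap≥0⇒RatAtMostC n x (cancel-pos 8 (by (identity (+ n) (+ x) v)
          (gap ⊕ slack ⊗ (nat 10 ⊗ sq≥0 (+ x) ⊕ nat 7 ⊗ nat x ⊗ (v≥0 ⊕ u≥0) ⊕ (v≥0 ⊗ v≥0 ⊕ v≥0 ⊗ u≥0 ⊕ sq≥0 u)))))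
    where
    u : ℤ
    u = + 3 * + n - + 8 * + x
    5u : ∀ n x → + 5 * (+ 3 * n - + 8 * x) ≡ (+ 15 * n - + 43 * x) + + 3 * x
    5u = solve-∀
    u≥0 : NonNeg u
    u≥0 = cancel-pos 4 (by (5u (+ n) (+ x))
      (ℤₚ.i≤j⇒0≤j-i (subst₂ ℤ._≤_ (ℤₚ.pos-* 43 x) (ℤₚ.pos-* 15 n) (+≤+ (ℕₚ.<⇒≤ (ℕₚ.≰⇒> nle)))) ⊕ nat 3 ⊗ nat x))
    rearrange : ∀ n x v → v - (+ 3 * n - + 8 * x) ≡ + 8 * x + v - + 3 * n
    rearrange = solve-∀
    slack : NonNeg (v - u)
    slack = by (rearrange (+ n) (+ x) v) le
    identity : ∀ n x v → let u = + 3 * n - + 8 * x in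
      + 9 * (+ 17 * (n * n) * x + + 17 * (x * x * x) - (+ 3 * (n * n * n) + + 30 * n * (x * x)))
      ≡ (+ 9 * (x * x * x) - v * (+ 10 * (x * x) + + 7 * x * v + v * v))
        + (v - u) * (+ 10 * (x * x) + + 7 * x * (v + u) + (v * v + v * u + u * u))
    identity = solve-∀

  -- `d₁` and `d₂` are `d₀` shifted once and twice along (x, y, z) ↦ (y, z, z + x).
  d₀ d₁ d₂ : ℤ → ℤ → ℤ → ℤ
  d₀ x y z = y * y - x * z
  d₁ x y z = z * z - y * (z + x)
  d₂ x y z = (z + x) * (z + x) - z * (y + z + x)

  -- d₀ shifted thrice along the recurrence is d₀ − d₁, so |d₀|, |d₁|, |d₂| stay below x/22, y/22, z/22.
  record Balanced (x y z : ℤ) : Set where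
    field
      x≥4   : NonNeg (x - + 4)
      x≤y   : NonNeg (y - x)
      y≤z   : NonNeg (z - y)
      y≤2x  : NonNeg (+ 2 * x - y)
      z≤2y  : NonNeg (+ 2 * y - z)
      z≤3x  : NonNeg (+ 3 * x - z)
      w₀≥4  : NonNeg (y + z - + 3 * x - + 4)
      w₁≥4  : NonNeg (+ 2 * z + x - + 3 * y - + 4)
      w₂≥4  : NonNeg (+ 2 * x + y - z - + 4)
      d₀≤   : NonNeg (x - + 22 * d₀ x y z)
      -d₀≤  : NonNeg (x + + 22 * d₀ x y z)
      d₁≤   : NonNeg (y - + 22 * d₁ x y z)
      -d₁≤  : NonNeg (y + + 22 * d₁ x y z)
      d₂≤   : NonNeg (z - + 22 * d₂ x y z)
      -d₂≤  : NonNeg (z + + 22 * d₂ x y z)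

  -- Most fields are shifts of one another. The new `d₂` is d₀ - d₁, of absolute value at most (x +
  -- y) / 22, and y ≤ z turns this into (z + x) / 22. The new `w₂` form is 2 y - x.
  Balanced-step : ∀ {x y z} → Balanced x y z → Balanced y z (z + x)
  Balanced-step {x} {y} {z} B = record
    { x≥4 = by (i₁ x y) (x≥4 ⊕ x≤y)
    ; x≤y = y≤z
    ; y≤z = by (i₂ x z) (x≥4 ⊕ nat 4)
    ; y≤2x = z≤2y
    ; z≤2y = by (i₃ x y z) (y≤z ⊕ x≤y)
    ; z≤3x = by (i₄ x y z) (z≤2y ⊕ x≤y)
    ; w₀≥4 = by (i₅ x y z) w₁≥4
    ; w₁≥4 = by (i₆ x y z) w₂≥4
    ; w₂≥4 = by (i₇ x y z) (x≥4 ⊕ nat 2 ⊗ x≤y)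
    ; d₀≤ = d₁≤
    ; -d₀≤ = -d₁≤
    ; d₁≤ = by (i₈ x y z) d₂≤
    ; -d₁≤ = by (i₉ x y z) -d₂≤
    ; d₂≤ = by (i₁₀ x y z) (d₀≤ ⊕ -d₁≤ ⊕ y≤z)
    ; -d₂≤ = by (i₁₁ x y z) (-d₀≤ ⊕ d₁≤ ⊕ y≤z)
    }
    where
    open Balanced B
    i₁ : ∀ x y → y - + 4 ≡ x - + 4 + (y - x)
    i₁ = solve-∀
    i₂ : ∀ x z → z + x - z ≡ x - + 4 + + 4
    i₂ = solve-∀
    i₃ : ∀ x y z → + 2 * z - (z + x) ≡ z - y + (y - x)
    i₃ = solve-∀
    i₄ : ∀ x y z → + 3 * y - (z + x) ≡ + 2 * y - z + (y - x)
    i₄ = solve-∀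
    i₅ : ∀ x y z → z + (z + x) - + 3 * y - + 4 ≡ + 2 * z + x - + 3 * y - + 4
    i₅ = solve-∀
    i₆ : ∀ x y z → + 2 * (z + x) + y - + 3 * z - + 4 ≡ + 2 * x + y - z - + 4
    i₆ = solve-∀
    i₇ : ∀ x y z → + 2 * y + z - (z + x) - + 4 ≡ x - + 4 + + 2 * (y - x)
    i₇ = solve-∀
    i₈ : ∀ x y z → z - + 22 * ((z + x) * (z + x) - z * (z + x + y)) ≡ z - + 22 * ((z + x) * (z + x) - z * (y + z + x))
    i₈ = solve-∀
    i₉ : ∀ x y z → z + + 22 * ((z + x) * (z + x) - z * (z + x + y)) ≡ z + + 22 * ((z + x) * (z + x) - z * (y + z + x))
    i₉ = solve-∀
    i₁₀ : ∀ x y z → z + x - + 22 * ((z + x + y) * (z + x + y) - (z + x) * (z + (z + x) + y))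
      ≡ x - + 22 * (y * y - x * z) + (y + + 22 * (z * z - y * (z + x))) + (z - y)
    i₁₀ = solve-∀
    i₁₁ : ∀ x y z → z + x + + 22 * ((z + x + y) * (z + x + y) - (z + x) * (z + (z + x) + y))
      ≡ x + + 22 * (y * y - x * z) + (y - + 22 * (z * z - y * (z + x))) + (z - y)
    i₁₁ = solve-∀

  -- The value of 3 n - 8 x at 3 n + 1 = 5 x + y + z, the greatest length that `Tight⇒RatAtMostC`
  -- admits.
  excess : ℤ → ℤ → ℤ → ℤ
  excess x y z = y + z - + 3 * x - + 1

  record Tight (x y z : ℤ) : Set where
    constructor tight
    field
      excess≥0  : NonNeg (excess x y z)
      deficit≥0 : NonNeg (deficit x (excess x y z))

  Tight⇒RatAtMostC : ∀ {x y z} n → Tight (+ x) (+ y) (+ z) → 3 ℕ.* n ℕ.+ 1 ℕ.≤ 5 ℕ.* x ℕ.+ y ℕ.+ z → RatAtMostC n x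
  Tight⇒RatAtMostC {x} {y} {z} n (tight e d) le = deficit≥0⇒RatAtMostC x n _ e d (by (rearrange (+ x) (+ y) (+ z) (+ n))
    (ℤₚ.i≤j⇒0≤j-i (subst₂ ℤ._≤_ (cong (λ i → i + + 1) (ℤₚ.pos-* 3 n)) (cong (λ i → i + + y + + z) (ℤₚ.pos-* 5 x)) (+≤+ le))))
    where
    rearrange : ∀ x y z n → + 8 * x + (y + z - + 3 * x - + 1) - + 3 * n ≡ + 5 * x + y + z - (+ 3 * n + + 1)
    rearrange = solve-∀

  module _ {x y z : ℤ} (B : Balanced x y z) where
    open Balanced B

    private
      f g w : ℤ
      f = + 2 * x - y
      g = + 3 * x - z
      w = y + z - + 3 * x
      shift : ∀ k → + 4 + (k - + 4) ≡ k
      shift = solve-∀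
      split : ∀ k → k - + 1 ≡ + 3 + (k - + 4)
      split = solve-∀
      cancel : ∀ x y → x + (y - x) ≡ y
      cancel = solve-∀
      x≥0 : NonNeg x
      x≥0 = subst NonNeg (shift x) (nat 4 ⊕ x≥4)
      x≥1 : NonNeg (x - + 1)
      x≥1 = by (split x) (nat 3 ⊕ x≥4)
      y≥0 : NonNeg y
      y≥0 = subst NonNeg (cancel x y) (x≥0 ⊕ x≤y)
      z≥0 : NonNeg z
      z≥0 = subst NonNeg (cancel y z) (y≥0 ⊕ y≤z)
      w≥0 : NonNeg w
      w≥0 = subst NonNeg (shift w) (nat 4 ⊕ w₀≥4)
      L₀≥0 : NonNeg (+ 2 * x + y + + 7 * z)
      L₀≥0 = nat 2 ⊗ x≥0 ⊕ y≥0 ⊕ nat 7 ⊗ z≥0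
      L₁≥0 : NonNeg (+ 5 * x + + 4 * y + z)
      L₁≥0 = nat 5 ⊗ x≥0 ⊕ nat 4 ⊗ y≥0 ⊕ z≥0
      -- This equals 66 x² - ((2 x + y + 7 z) x + (5 x + 4 y + z) y + 3 x z): by y ≤ 2 x and z ≤ 3
      -- x, the bounds on the quadrics cost at most 66 x² in 22 times the deficit.
      margin : NonNeg ((f + + 7 * g) * x + (+ 4 * f + g) * y + + 16 * x * f + + 3 * x * g)
      margin = (y≤2x ⊕ nat 7 ⊗ z≤3x) ⊗ x≥0 ⊕ (nat 4 ⊗ y≤2x ⊕ z≤3x) ⊗ y≥0 ⊕ nat 16 ⊗ x≥0 ⊗ y≤2x ⊕ nat 3 ⊗ x≥0 ⊗ z≤3x

    -- Both certificates rest on  deficit x (y + z − 3 x) = 3 x d₂ − (2 x + y + 7 z) d₀ − (5 x + 4 y + z) d₁.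
    Balanced⇒Tight : Tight x y z
    Balanced⇒Tight = tight (by (split w) (nat 3 ⊕ w₀≥4)) (cancel-pos 21 (by (identity x y z)
      (L₀≥0 ⊗ d₀≤ ⊕ L₁≥0 ⊗ d₁≤ ⊕ nat 3 ⊗ x≥0 ⊗ -d₂≤ ⊕ margin
        -- Lowering the argument of `deficit` from w to w - 1 gains 10 x² + 7 x (2 w - 1) + 3 w² - 3
        -- w + 1. The summand here is 22 times that gain, less the 66 x² lost.
        ⊕ (nat 154 ⊗ x≥0 ⊗ x≥1 ⊕ nat 66 ⊗ x≥1 ⊗ w≥0 ⊕ nat 242 ⊗ x≥0 ⊗ w≥0 ⊕ nat 66 ⊗ (w≥0 ⊗ w≥0) ⊕ nat 22))))
      where
      identity : ∀ x y z → let d0 = y * y - x * z; d1 = z * z - y * (z + x); d2 = (z + x) * (z + x) - z * (y + z + x)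
                               f = + 2 * x - y; g = + 3 * x - z ; w = y + z - + 3 * x; v = y + z - + 3 * x - + 1 in
        + 22 * (+ 9 * (x * x * x) - v * (+ 10 * (x * x) + + 7 * x * v + v * v))
        ≡ (+ 2 * x + y + + 7 * z) * (x - + 22 * d0) + (+ 5 * x + + 4 * y + z) * (y - + 22 * d1) + + 3 * x * (z + + 22 * d2)
          + ((f + + 7 * g) * x + (+ 4 * f + g) * y + + 16 * x * f + + 3 * x * g)
          + (+ 154 * x * (x - + 1) + + 66 * (x - + 1) * w + + 242 * x * w + + 66 * (w * w) + + 22)
      identity = solve-∀

    -- 203 = 3 + 200: the quadrics contribute 66 / 22, and lowering the argument of `deficit` from w
    -- to w - 4 adds at most 200 x², because w ≤ 2 x. The 4 is that of 3 n + 4 = 5 x + y + z, which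
    -- the repetitions of the lower bound satisfy.
    deficit≤203x² : NonNeg (+ 203 * (x * x) - deficit x (w - + 4))
    deficit≤203x² = cancel-pos 21 (by (identity x y z)
      (L₀≥0 ⊗ -d₀≤ ⊕ L₁≥0 ⊗ -d₁≤ ⊕ nat 3 ⊗ x≥0 ⊗ d₂≤ ⊕ margin
        ⊕ nat 22 ⊗ ((nat 80 ⊗ x≥0 ⊕ nat 12 ⊗ w≥0) ⊗ (y≤2x ⊕ z≤3x) ⊕ nat 112 ⊗ x≥4 ⊕ nat 48 ⊗ w≥0 ⊕ nat 384)))
      where
      identity : ∀ x y z → let d0 = y * y - x * z; d1 = z * z - y * (z + x); d2 = (z + x) * (z + x) - z * (y + z + x)
                               f = + 2 * x - y; g = + 3 * x - z ; w = y + z - + 3 * x; q = y + z - + 3 * x - + 4 in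
        + 22 * (+ 203 * (x * x) - (+ 9 * (x * x * x) - q * (+ 10 * (x * x) + + 7 * x * q + q * q)))
        ≡ (+ 2 * x + y + + 7 * z) * (x + + 22 * d0) + (+ 5 * x + + 4 * y + z) * (y + + 22 * d1) + + 3 * x * (z - + 22 * d2)
          + ((f + + 7 * g) * x + (+ 4 * f + g) * y + + 16 * x * f + + 3 * x * g)
          + + 22 * ((+ 80 * x + + 12 * w) * (f + g) + + 112 * (x - + 4) + + 48 * w + + 384)
      identity = solve-∀

    -- The cubic deficit of n / x is at most 203 x²; that of a / b ≥ n / x, scaled by x³ / b³, is no larger,
    -- while by integrality it is at least 9 x³ / b³.
    RatBelowC⇒small : ∀ {a b n} → + 3 * n + + 4 ≡ + 5 * x + y + z → NonNeg b →
      NonNeg (cubicGap a b - + 1) → NonNeg (a * x - n * b) → NonNeg (+ 203 * (b * b * b) * (x * x) - + 9 * (x * x * x))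
    RatBelowC⇒small {a} {b} {n} eq b≥0 gap le = by (identity x b (w - + 4) a)
      (b≥0 ⊗ b≥0 ⊗ b≥0 ⊗ deficit≤203x² ⊕ s≥0 ⊗ (nat 10 ⊗ sq≥0 bx ⊕ nat 7 ⊗ bx≥0 ⊗ (V≥0 ⊕ qb≥0) ⊕ (V≥0 ⊗ V≥0 ⊕ V≥0 ⊗ qb≥0 ⊕ qb≥0 ⊗ qb≥0))
        ⊕ nat 9 ⊗ (x≥0 ⊗ x≥0 ⊗ x≥0) ⊗ gap)
      where
      bx = b * x
      V = (+ 3 * a - + 8 * b) * x
      qb = (w - + 4) * b
      bx≥0 : NonNeg bx
      bx≥0 = b≥0 ⊗ x≥0
      qb≥0 : NonNeg qb
      qb≥0 = w₀≥4 ⊗ b≥0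
      -- By `eq`, 3 n - 8 x = w - 4, so the difference V - qb is just 3 (a x - n b).
      s-eq : ∀ a b x y z n → (+ 3 * a - + 8 * b) * x - (y + z - + 3 * x - + 4) * b
        ≡ + 3 * (a * x - n * b) + ((+ 3 * n + + 4) - (+ 5 * x + y + z)) * b
      s-eq = solve-∀
      s≥0 : NonNeg (V - qb)
      s≥0 = by (s-eq a b x y z n) (nat 3 ⊗ le ⊕ by (cong (λ i → (i - (+ 5 * x + y + z)) * b) eq)
        (by (cong (λ i → i * b) (ℤₚ.+-inverseʳ (+ 5 * x + y + z))) (nat 0 ⊗ b≥0)))
      restore : ∀ i j → i ≡ i - j + j
      restore = solve-∀
      V≥0 : NonNeg V
      V≥0 = by (restore V qb) (s≥0 ⊕ qb≥0)
      identity : ∀ x b q a → let V = (+ 3 * a - + 8 * b) * x; qb = q * b; bx = b * x in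
        + 203 * (b * b * b) * (x * x) - + 9 * (x * x * x)
        ≡ b * b * b * (+ 203 * (x * x) - (+ 9 * (x * x * x) - q * (+ 10 * (x * x) + + 7 * x * q + q * q)))
          + (V - qb) * (+ 10 * (bx * bx) + + 7 * bx * (V + qb) + (V * V + V * qb + qb * qb))
          + + 9 * (x * x * x) * (+ 17 * (a * a) * b + + 17 * (b * b * b) - (+ 3 * (a * a * a) + + 30 * a * (b * b)) - + 1)
      identity = solve-∀

open Cubic

open import Data.Nat
open import Data.Nat.Properties
open import Data.Nat.Tactic.RingSolver using (solve-∀)
open import Data.Product using (_×_; _,_; ∃; ∃-syntax; proj₁; proj₂)
open import Data.Sum using (_⊎_; inj₁; inj₂)
open import Data.Empty using (⊥; ⊥-elim)
open import Relation.Nullary using (¬_; Dec; yes; no; contradiction; _×-dec_)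
open import Relation.Nullary.Decidable using (map′)
open import Relation.Binary.PropositionalEquality

-- Letters, the squared Narayana morphism and its mismatches.

data Letter : Set where
  a b c : Letter

-- The squared Narayana morphism a ↦ acb, b ↦ ac, c ↦ a: every image is a prefix of acb.
len : Letter → ℕ
len a = 3
len b = 2
len c = 1

acb : ℕ → Letter
acb 0 = a
acb 1 = c
acb _ = b

-- Mismatch t l l′: l and l′ differ, and their images have a longest common continuation of length t.
data Mismatch : ℕ → Letter → Letter → Set where
  ab : Mismatch 2 a b
  ba : Mismatch 2 b a
  ac : Mismatch 1 a c
  ca : Mismatch 1 c a
  bc : Mismatch 1 b c
  cb : Mismatch 1 c b

compareLetters : ∀ l l′ → l ≡ l′ ⊎ ∃[ t ] Mismatch t l l′
compareLetters a a = inj₁ refl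
compareLetters a b = inj₂ (_ , ab)
compareLetters a c = inj₂ (_ , ac)
compareLetters b a = inj₂ (_ , ba)
compareLetters b b = inj₁ refl
compareLetters b c = inj₂ (_ , bc)
compareLetters c a = inj₂ (_ , ca)
compareLetters c b = inj₂ (_ , cb)
compareLetters c c = inj₁ refl

Mismatch-irrefl : ∀ {t l l′} → Mismatch t l l′ → l ≢ l′
Mismatch-irrefl ab ()
Mismatch-irrefl ba ()
Mismatch-irrefl ac ()
Mismatch-irrefl ca ()
Mismatch-irrefl bc ()
Mismatch-irrefl cb ()

Mismatch-functional : ∀ {t t′ l l′} → Mismatch t l l′ → Mismatch t′ l l′ → t ≡ t′
Mismatch-functional ab ab = refl
Mismatch-functional ba ba = refl
Mismatch-functional ac ac = refl
Mismatch-functional ca ca = refl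
Mismatch-functional bc bc = refl
Mismatch-functional cb cb = refl

acb-injective : ∀ {r r′} → r < 3 → r′ < 3 → acb r ≡ acb r′ → r ≡ r′
acb-injective {0} {0} _ _ _ = refl
acb-injective {1} {1} _ _ _ = refl
acb-injective {2} {2} _ _ _ = refl
acb-injective {0} {1} _ _ ()
acb-injective {0} {suc (suc _)} _ _ ()
acb-injective {1} {0} _ _ ()
acb-injective {1} {suc (suc _)} _ _ ()
acb-injective {suc (suc _)} {0} _ _ ()
acb-injective {suc (suc _)} {1} _ _ ()
acb-injective {suc (suc (suc _))} {_} (s≤s (s≤s (s≤s ()))) _ _
acb-injective {_} {suc (suc (suc _))} _ (s≤s (s≤s (s≤s ()))) _

len≥1 : ∀ l → 1 ≤ len l
len≥1 a = s≤s z≤n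
len≥1 b = s≤s z≤n
len≥1 c = s≤s z≤n

len≤3 : ∀ l → len l ≤ 3
len≤3 a = ≤-refl
len≤3 b = n≤1+n 2
len≤3 c = s≤s z≤n

-- Lengths of iterated images: the Narayana numbers.

weight : ℕ → Letter → ℕ
weight zero    _ = 1
weight (suc k) a = weight k a + weight k c + weight k b
weight (suc k) b = weight k a + weight k c
weight (suc k) c = weight k a

-- In terms of the Narayana numbers N(k+3) = N(k+2) + N(k): X k, Y k, Z k = N(2k), N(2k+1), N(2k+2),
-- with N(0) = N(1) = N(2) = 1.
X Y Z : ℕ → ℕ
X k = weight k c
Y k = weight k b
Z k = weight k a

-- Length of the j-th image of the common continuation, which is the letter a for t = 1 and the word
-- ac, the image of b, for t = 2.
tailWeight : ℕ → ℕ → ℕ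
tailWeight 2 j = weight (suc j) b
tailWeight _ j = weight j a

-- Starting from an empty match in front of a mismatch of type t, apply the morphism k times, prolonging the
-- match by t each time; overhang t j k is the length of the j-th image of the resulting match.
overhang : ℕ → ℕ → ℕ → ℕ
overhang t j zero    = 0
overhang t j (suc k) = overhang t (suc j) k + tailWeight t j

tailWeight-zero : ∀ {t l l′} → Mismatch t l l′ → tailWeight t 0 ≡ t
tailWeight-zero ab = refl
tailWeight-zero ba = refl
tailWeight-zero ac = refl
tailWeight-zero ca = refl
tailWeight-zero bc = refl
tailWeight-zero cb = refl

X≥1 : ∀ k → 1 ≤ X k
Y≥1 : ∀ k → 1 ≤ Y k
Z≥1 : ∀ k → 1 ≤ Z k
X≥1 zero = ≤-refl
X≥1 (suc k) = Z≥1 k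
Y≥1 zero = ≤-refl
Y≥1 (suc k) = ≤-trans (Z≥1 k) (m≤m+n _ _)
Z≥1 zero = ≤-refl
Z≥1 (suc k) = ≤-trans (Z≥1 k) (≤-trans (m≤m+n _ _) (m≤m+n _ _))

X≤Y : ∀ k → X k ≤ Y k
X≤Y zero = ≤-refl
X≤Y (suc k) = m≤m+n _ _

Y≤Z : ∀ k → Y k ≤ Z k
Y≤Z zero = ≤-refl
Y≤Z (suc k) = m≤m+n _ _

Z≤X+Y : ∀ k → Z k ≤ X k + Y k
Z≤X+Y zero = s≤s z≤n
Z≤X+Y (suc k) = subst (_≤ Z k + (Z k + X k)) (+-comm (Y k) (Z k + X k)) (+-monoˡ-≤ (Z k + X k) (Y≤Z k))

Y≤2X : ∀ k → Y k ≤ X k + X k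
Y≤2X zero = s≤s z≤n
Y≤2X (suc k) = +-monoʳ-≤ (Z k) (≤-trans (X≤Y k) (Y≤Z k))

k<Z : ∀ k → k < Z k
k<Z zero = ≤-refl
k<Z (suc k) = subst (_≤ Z k + X k + Y k) (+-comm (suc k) 1)
  (+-mono-≤ (≤-trans (k<Z k) (m≤m+n _ _)) (Y≥1 k))

-- The sum telescopes: one application of the morphism raises Z + Y + 2 X by three times the summand
-- Z. In `overhang₂` the summand is Z + X and the form X + 2 Z + 2 Y.
overhang₁ : ∀ k j → 3 * overhang 1 j k + (Z j + Y j + 2 * X j) ≡ Z (k + j) + Y (k + j) + 2 * X (k + j)
overhang₁ zero j = refl
overhang₁ (suc k) j = begin
  3 * (overhang 1 (suc j) k + Z j) + (Z j + Y j + 2 * X j)          ≡⟨ regroup (overhang 1 (suc j) k) (X j) (Y j) (Z j) ⟩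
  3 * overhang 1 (suc j) k + (Z (suc j) + Y (suc j) + 2 * X (suc j)) ≡⟨ overhang₁ k (suc j) ⟩
  _                                                                 ≡⟨ cong (λ n → Z n + Y n + 2 * X n) (+-suc k j) ⟩
  _ ∎
  where
  open ≡-Reasoning
  regroup : ∀ o x y z → 3 * (o + z) + (z + y + 2 * x) ≡ 3 * o + (z + x + y + (z + x) + 2 * z)
  regroup = solve-∀

overhang₂ : ∀ k j → 3 * overhang 2 j k + (X j + 2 * Z j + 2 * Y j) ≡ X (k + j) + 2 * Z (k + j) + 2 * Y (k + j)
overhang₂ zero j = refl
overhang₂ (suc k) j = begin
  3 * (overhang 2 (suc j) k + (Z j + X j)) + (X j + 2 * Z j + 2 * Y j) ≡⟨ regroup (overhang 2 (suc j) k) (X j) (Y j) (Z j) ⟩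
  3 * overhang 2 (suc j) k + (X (suc j) + 2 * Z (suc j) + 2 * Y (suc j)) ≡⟨ overhang₂ k (suc j) ⟩
  _ ≡⟨ cong (λ n → X n + 2 * Z n + 2 * Y n) (+-suc k j) ⟩
  _ ∎
  where
  open ≡-Reasoning
  regroup : ∀ o x y z → 3 * (o + (z + x)) + (x + 2 * z + 2 * y) ≡ 3 * o + (z + 2 * (z + x + y) + 2 * (z + x))
  regroup = solve-∀

-- Matches in the fixed point and their desubstitution.

module FixedPoint
  (y : ℕ → Letter) (R : ℕ → ℕ)
  (R-zero : R 0 ≡ 0)
  (R-suc : ∀ u → R (suc u) ≡ R u + len (y u))
  (y-block : ∀ u r → r < len (y u) → y (R u + r) ≡ acb r)
  where

  open ≡-Reasoning

  y-start : ∀ u → y (R u) ≡ a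
  y-start u = trans (cong y (sym (+-identityʳ (R u)))) (y-block u 0 (len≥1 (y u)))

  y-end : ∀ u → y (R u + len (y u)) ≡ a
  y-end u = trans (cong y (sym (R-suc u))) (y-start (suc u))

  blockOf : ∀ i → ∃[ u ] ∃[ r ] (r < len (y u) × i ≡ R u + r)
  blockOf zero = 0 , 0 , len≥1 (y 0) , sym (trans (+-identityʳ (R 0)) R-zero)
  blockOf (suc i) with blockOf i
  ... | u , r , r< , eq with suc r <? len (y u)
  ...   | yes r+1< = u , suc r , r+1< , trans (cong suc eq) (sym (+-suc (R u) r))
  ...   | no r+1≮ = suc u , 0 , len≥1 (y (suc u)) , (begin
          suc i               ≡⟨ cong suc eq ⟩
          suc (R u + r)       ≡⟨ sym (+-suc (R u) r) ⟩
          R u + suc r         ≡⟨ cong (R u +_) (≤-antisym r< (≮⇒≥ r+1≮)) ⟩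
          R u + len (y u)     ≡⟨ sym (R-suc u) ⟩
          R (suc u)           ≡⟨ sym (+-identityʳ _) ⟩
          R (suc u) + 0       ∎)

  y0≡a : y 0 ≡ a
  y0≡a = trans (cong y (sym R-zero)) (y-start 0)

  -- The first block has length 3 and the others at least 1. This makes desubstitution move strictly
  -- to the left.
  R-expands : ∀ u → suc u < R (suc u)
  R-expands zero = subst (1 <_) (sym (trans (R-suc 0) (cong₂ _+_ R-zero (cong len y0≡a)))) (s≤s (s≤s z≤n))
  R-expands (suc u) = subst (suc (suc u) <_) (sym (R-suc (suc u)))
    (subst (_≤ R (suc u) + len (y (suc u))) (+-comm (suc (suc u)) 1) (+-mono-≤ (R-expands u) (len≥1 (y (suc u)))))

  R-mono : ∀ {u v} → u ≤ v → R u ≤ R v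
  R-mono {u} u≤v with m≤n⇒∃[o]m+o≡n u≤v
  ... | o , refl = go o
    where
    go : ∀ o → R u ≤ R (u + o)
    go zero = ≤-reflexive (cong R (sym (+-identityʳ u)))
    go (suc o) = ≤-trans (go o) (subst (λ n → R (u + o) ≤ n) (trans (sym (R-suc (u + o))) (cong R (sym (+-suc u o)))) (m≤m+n _ _))

  R-cancel-< : ∀ {u v} → R u < R v → u < v
  R-cancel-< Ru<Rv = ≰⇒> λ v≤u → <⇒≱ Ru<Rv (R-mono v≤u)

  -- A repetition of period i′ - i and excess m over the period. Two positions are kept rather than
  -- a period, since the morphism changes their distance.
  Match : ℕ → ℕ → ℕ → Set
  Match i i′ m = ∀ j → j < m → y (i + j) ≡ y (i′ + j)

  Match-≤ : ∀ {i i′ m n} → m ≤ n → Match i i′ n → Match i i′ m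
  Match-≤ m≤n M j j<m = M j (<-≤-trans j<m m≤n)

  Match-++ : ∀ {i i′ m n} → Match i i′ m → Match (i + m) (i′ + m) n → Match i i′ (m + n)
  Match-++ {i} {i′} {m} {n} M N j j<m+n with j <? m
  ... | yes j<m = M j j<m
  ... | no j≮m with m≤n⇒∃[o]m+o≡n (≮⇒≥ j≮m)
  ...   | o , refl = begin
    y (i + (m + o))  ≡⟨ cong y (sym (+-assoc i m o)) ⟩
    y (i + m + o)    ≡⟨ N o (+-cancelˡ-< m o n j<m+n) ⟩
    y (i′ + m + o)   ≡⟨ cong y (+-assoc i′ m o) ⟩
    y (i′ + (m + o)) ∎

  Match-drop : ∀ {i i′} m {n} → Match i i′ (m + n) → Match (i + m) (i′ + m) n
  Match-drop {i} {i′} m {n} M o o<n = begin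
    y (i + m + o)    ≡⟨ cong y (+-assoc i m o) ⟩
    y (i + (m + o))  ≡⟨ M (m + o) (+-monoʳ-< m o<n) ⟩
    y (i′ + (m + o)) ≡⟨ cong y (sym (+-assoc i′ m o)) ⟩
    y (i′ + m + o)   ∎

  Match-head : ∀ {i i′ m} → Match i i′ (suc m) → y i ≡ y i′
  Match-head {i} {i′} M = subst₂ (λ j j′ → y j ≡ y j′) (+-identityʳ i) (+-identityʳ i′) (M 0 (s≤s z≤n))

  Match-tail : ∀ {i i′ m} → Match i i′ (suc m) → Match (suc i) (suc i′) m
  Match-tail {i} {i′} {m} M = subst₂ (λ j j′ → Match j j′ m) (+-comm i 1) (+-comm i′ 1) (Match-drop 1 M)

  span : ℕ → ℕ → ℕ
  span u zero = 0
  span u (suc m) = len (y u) + span (suc u) m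

  R-span : ∀ u m → R (u + m) ≡ R u + span u m
  R-span u zero = trans (cong R (+-identityʳ u)) (sym (+-identityʳ (R u)))
  R-span u (suc m) = begin
    R (u + suc m)                        ≡⟨ cong R (+-suc u m) ⟩
    R (suc u + m)                        ≡⟨ R-span (suc u) m ⟩
    R (suc u) + span (suc u) m           ≡⟨ cong (_+ span (suc u) m) (R-suc u) ⟩
    R u + len (y u) + span (suc u) m     ≡⟨ +-assoc (R u) _ _ ⟩
    R u + (len (y u) + span (suc u) m)   ∎

  span-+ : ∀ u m n → span u (m + n) ≡ span u m + span (u + m) n
  span-+ u zero n = cong (λ v → span v n) (sym (+-identityʳ u))
  span-+ u (suc m) n = begin
    len (y u) + span (suc u) (m + n)                   ≡⟨ cong (len (y u) +_) (span-+ (suc u) m n) ⟩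
    len (y u) + (span (suc u) m + span (suc u + m) n)  ≡⟨ sym (+-assoc (len (y u)) _ _) ⟩
    len (y u) + span (suc u) m + span (suc u + m) n    ≡⟨ cong (λ v → len (y u) + span (suc u) m + span v n) (sym (+-suc u m)) ⟩
    len (y u) + span (suc u) m + span (u + suc m) n    ∎

  span-mono : ∀ u {m n} → m ≤ n → span u m ≤ span u n
  span-mono u {m} m≤n with m≤n⇒∃[o]m+o≡n m≤n
  ... | o , refl = subst (span u m ≤_) (sym (span-+ u m o)) (m≤m+n _ _)

  span-Match : ∀ {u u′} m → Match u u′ m → span u m ≡ span u′ m
  span-Match zero M = refl
  span-Match (suc m) M = cong₂ _+_ (cong len (Match-head M)) (span-Match m (Match-tail M))

  block-Match : ∀ {u u′} → y u ≡ y u′ → Match (R u) (R u′) (len (y u))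
  block-Match {u} {u′} eq j j< = trans (y-block u j j<) (sym (y-block u′ j (subst (λ l → j < len l) eq j<)))

  atOffset : ∀ {u l} r → y u ≡ l → r < len l → y (R u + r) ≡ acb r
  atOffset {u} r refl r< = y-block u r r<

  atEnd : ∀ {u l} → y u ≡ l → y (R u + len l) ≡ a
  atEnd {u} refl = y-end u

  -- The shorter image, of length t, is a prefix of the longer one and is followed by the a of the
  -- next block, against c or b inside the longer image. So t is preserved: `ab` and `ba` are
  -- exchanged, and the others turn into `ac` or `ca`.
  Mismatch-image : ∀ {u u′ t} → Mismatch t (y u) (y u′) →
    Match (R u) (R u′) t × Mismatch t (y (R u + t)) (y (R u′ + t))
  Mismatch-image {u} {u′} {t} mis = helper mis refl refl
    where
    commonPrefix : ∀ {t l l′} → y u ≡ l → y u′ ≡ l′ → t ≤ len l → t ≤ len l′ → Match (R u) (R u′) t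
    commonPrefix eq eq′ t≤ t≤′ j j<t =
      trans (atOffset j eq (<-≤-trans j<t t≤)) (sym (atOffset j eq′ (<-≤-trans j<t t≤′)))
    helper : ∀ {t l l′} → Mismatch t l l′ → y u ≡ l → y u′ ≡ l′ →
      Match (R u) (R u′) t × Mismatch t (y (R u + t)) (y (R u′ + t))
    helper ab eq eq′ = commonPrefix eq eq′ (n≤1+n 2) ≤-refl ,
      subst₂ (Mismatch 2) (sym (atOffset 2 eq ≤-refl)) (sym (atEnd eq′)) ba
    helper ba eq eq′ = commonPrefix eq eq′ ≤-refl (n≤1+n 2) ,
      subst₂ (Mismatch 2) (sym (atEnd eq)) (sym (atOffset 2 eq′ ≤-refl)) ab
    helper ac eq eq′ = commonPrefix eq eq′ (s≤s z≤n) ≤-refl ,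
      subst₂ (Mismatch 1) (sym (atOffset 1 eq (s≤s (s≤s z≤n)))) (sym (atEnd eq′)) ca
    helper ca eq eq′ = commonPrefix eq eq′ ≤-refl (s≤s z≤n) ,
      subst₂ (Mismatch 1) (sym (atEnd eq)) (sym (atOffset 1 eq′ (s≤s (s≤s z≤n)))) ac
    helper bc eq eq′ = commonPrefix eq eq′ (s≤s z≤n) ≤-refl ,
      subst₂ (Mismatch 1) (sym (atOffset 1 eq ≤-refl)) (sym (atEnd eq′)) ca
    helper cb eq eq′ = commonPrefix eq eq′ ≤-refl (s≤s z≤n) ,
      subst₂ (Mismatch 1) (sym (atEnd eq)) (sym (atOffset 1 eq′ ≤-refl)) ac

  Match-image : ∀ {u u′} m → Match u u′ m → Match (R u) (R u′) (span u m)
  Match-image zero M j ()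
  Match-image {u} {u′} (suc m) M = Match-++ (block-Match eq)
    (subst₂ (λ i i′ → Match i i′ (span (suc u) m)) (R-suc u) (trans (R-suc u′) (cong (λ l → R u′ + len l) (sym eq)))
      (Match-image m (Match-tail M)))
    where eq = Match-head M

  Match-image-extended : ∀ {u u′ t} m → Match u u′ m → Mismatch t (y (u + m)) (y (u′ + m)) →
    Match (R u) (R u′) (span u m + t) × Mismatch t (y (R u + (span u m + t))) (y (R u′ + (span u m + t)))
  Match-image-extended {u} {u′} {t} m M mis with Mismatch-image mis
  ... | N , mis′ =
    Match-++ (Match-image m M) (subst₂ (λ i i′ → Match i i′ t) at at′ N) ,
    subst₂ (λ i i′ → Mismatch t (y i) (y i′)) (trans (cong (_+ t) at) (+-assoc (R u) _ t)) (trans (cong (_+ t) at′) (+-assoc (R u′) _ t)) mis′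
    where
    at : R (u + m) ≡ R u + span u m
    at = R-span u m
    at′ : R (u′ + m) ≡ R u′ + span u m
    at′ = trans (R-span u′ m) (cong (R u′ +_) (sym (span-Match m M)))

  -- The second alternative allows m = 0, where the match arises from a mismatch alone; `1 ≤ m` in
  -- the first keeps the preimage nonempty for the recursion in `Match⇒Inside`.
  Preimage : ℕ → ℕ → ℕ → Set
  Preimage u u′ q = ∃[ m ] (Match u u′ m ×
    ((1 ≤ m × q ≤ span u m) ⊎ ∃[ t ] (Mismatch t (y (u + m)) (y (u′ + m)) × q ≤ span u m + t)))

  -- Blocks are compared one by one. Equal letters have equal images, which are dropped while the
  -- match is longer; at unequal letters `Mismatch-image` stops it after t letters. `fuel` bounds q,
  -- and each dropped block is nonempty.
  preimage : ∀ fuel u u′ q → q ≤ fuel → Match (R u) (R u′) q → Preimage u u′ q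
  preimage fuel u u′ q q≤fuel M with compareLetters (y u) (y u′)
  ... | inj₂ (t , mis) = 0 , (λ _ ()) , inj₂ (t ,
        subst₂ (λ i i′ → Mismatch t (y i) (y i′)) (sym (+-identityʳ u)) (sym (+-identityʳ u′)) mis ,
        ≮⇒≥ (λ t<q → Mismatch-irrefl (proj₂ (Mismatch-image mis)) (M t t<q)))
  ... | inj₁ eq with q ≤? len (y u)
  ...   | yes q≤ = 1 , single , inj₁ (≤-refl , subst (q ≤_) (sym (+-identityʳ _)) q≤)
    where
    single : Match u u′ 1
    single zero _ = subst₂ (λ i i′ → y i ≡ y i′) (sym (+-identityʳ u)) (sym (+-identityʳ u′)) eq
    single (suc _) (s≤s ())
  preimage zero u u′ q q≤0 M | inj₁ eq | no q≰ = contradiction (≤-trans q≤0 z≤n) q≰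
  preimage (suc fuel) u u′ q q≤fuel M | inj₁ eq | no q≰ with m≤n⇒∃[o]m+o≡n (≰⇒≥ q≰)
  ... | o , refl = extend (preimage fuel (suc u) (suc u′) o
          (≤-pred (≤-trans (+-monoˡ-≤ o (len≥1 (y u))) q≤fuel))
          (subst₂ (λ i i′ → Match i i′ o) (sym (R-suc u)) (sym (trans (R-suc u′) (cong (λ l → R u′ + len l) (sym eq)))) (Match-drop (len (y u)) M)))
    where
    L = len (y u)
    extend : Preimage (suc u) (suc u′) o → Preimage u u′ (L + o)
    extend (m , N , end) = suc m , cons , end′ end
      where
      cons : Match u u′ (suc m)
      cons zero _ = subst₂ (λ i i′ → y i ≡ y i′) (sym (+-identityʳ u)) (sym (+-identityʳ u′)) eq
      cons (suc j) (s≤s j<m) = subst₂ (λ i i′ → y i ≡ y i′) (sym (+-suc u j)) (sym (+-suc u′ j)) (N j j<m)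
      end′ : _ → _
      end′ (inj₁ (_ , o≤)) = inj₁ (s≤s z≤n , +-monoʳ-≤ L o≤)
      end′ (inj₂ (t , mis , o≤)) = inj₂ (t ,
        subst₂ (λ i i′ → Mismatch t (y i) (y i′)) (sym (+-suc u m)) (sym (+-suc u′ m)) mis ,
        subst (L + o ≤_) (sym (+-assoc L _ t)) (+-monoʳ-≤ L o≤))

  -- Iterated images and canonical matches.

  R^ : ℕ → ℕ → ℕ
  R^ zero u = u
  R^ (suc k) u = R^ k (R u)

  R^-comm : ∀ k u → R (R^ k u) ≡ R^ k (R u)
  R^-comm zero u = refl
  R^-comm (suc k) u = R^-comm k (R u)

  R^-suc : ∀ k u → R^ k (suc u) ≡ R^ k u + weight k (y u)
  R^-start : ∀ k u → R^ k (suc (R u)) ≡ R^ k (R u) + weight k a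
  R^-second : ∀ k u → 2 ≤ len (y u) → R^ k (suc (suc (R u))) ≡ R^ k (R u) + (weight k a + weight k c)
  R^-start k u = trans (R^-suc k (R u)) (cong (λ l → R^ k (R u) + weight k l) (y-start u))
  R^-second k u 2≤ = begin
    R^ k (suc (suc (R u)))                             ≡⟨ R^-suc k (suc (R u)) ⟩
    R^ k (suc (R u)) + weight k (y (suc (R u)))        ≡⟨ cong₂ _+_ (R^-start k u) (cong (weight k) (trans (cong y (+-comm 1 (R u))) (y-block u 1 2≤))) ⟩
    R^ k (R u) + weight k a + weight k c               ≡⟨ +-assoc (R^ k (R u)) _ _ ⟩
    R^ k (R u) + (weight k a + weight k c)             ∎
  R^-suc zero u = +-comm 1 u
  R^-suc (suc k) u = helper (y u) refl
    where
    helper : ∀ l → y u ≡ l → R^ k (R (suc u)) ≡ R^ k (R u) + weight (suc k) l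
    helper c eq = trans (cong (R^ k) (trans (R-suc u) (trans (cong (λ l → R u + len l) eq) (+-comm (R u) 1)))) (R^-start k u)
    helper b eq = trans (cong (R^ k) (trans (R-suc u) (trans (cong (λ l → R u + len l) eq) (+-comm (R u) 2))))
      (R^-second k u (subst (λ l → 2 ≤ len l) (sym eq) ≤-refl))
    helper a eq = begin
      R^ k (R (suc u))                                        ≡⟨ cong (R^ k) (trans (R-suc u) (trans (cong (λ l → R u + len l) eq) (+-comm (R u) 3))) ⟩
      R^ k (suc (suc (suc (R u))))                            ≡⟨ R^-suc k (suc (suc (R u))) ⟩
      R^ k (suc (suc (R u))) + weight k (y (suc (suc (R u)))) ≡⟨ cong₂ _+_ (R^-second k u (subst (λ l → 2 ≤ len l) (sym eq) (n≤1+n 2)))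
                                                                   (cong (weight k) (trans (cong y (+-comm 2 (R u))) (atOffset 2 eq ≤-refl))) ⟩
      R^ k (R u) + (weight k a + weight k c) + weight k b     ≡⟨ +-assoc (R^ k (R u)) _ _ ⟩
      R^ k (R u) + weight (suc k) a                           ∎

  R^-tail : ∀ j {w t l′} → Mismatch t (y w) l′ → R^ j (R w + t) ≡ R^ j (R w) + tailWeight t j
  R^-tail j {w} mis = helper mis refl
    where
    one : R^ j (R w + 1) ≡ R^ j (R w) + weight j a
    one = trans (cong (R^ j) (+-comm (R w) 1)) (R^-start j w)
    two : ∀ {l} → y w ≡ l → 2 ≤ len l → R^ j (R w + 2) ≡ R^ j (R w) + weight (suc j) b
    two eq 2≤ = trans (cong (R^ j) (+-comm (R w) 2)) (R^-second j w (subst (λ l → 2 ≤ len l) (sym eq) 2≤))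
    helper : ∀ {t l l′} → Mismatch t l l′ → y w ≡ l → R^ j (R w + t) ≡ R^ j (R w) + tailWeight t j
    helper ab eq = two eq (n≤1+n 2)
    helper ba eq = two eq ≤-refl
    helper ac eq = one
    helper ca eq = one
    helper bc eq = one
    helper cb eq = one

  module _ {i₀ i₀′ t : ℕ} (mis₀ : Mismatch t (y i₀) (y i₀′)) where

    -- `iterated` is stated for all j because stage k + 1 at j uses stage k at j + 1; at j = 1 it
    -- gives the length of the image of the match.
    record Canonical (k : ℕ) : Set where
      field
        match    : Match (R^ k i₀) (R^ k i₀′) (overhang t 0 k)
        mismatch : Mismatch t (y (R^ k i₀ + overhang t 0 k)) (y (R^ k i₀′ + overhang t 0 k))
        iterated : ∀ j → R^ j (R^ k i₀ + overhang t 0 k) ≡ R^ j (R^ k i₀) + overhang t j k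

      span-overhang : span (R^ k i₀) (overhang t 0 k) ≡ overhang t 1 k
      span-overhang = +-cancelˡ-≡ (R (R^ k i₀)) _ _ (trans (sym (R-span (R^ k i₀) (overhang t 0 k))) (iterated 1))

    canonical : ∀ k → Canonical k
    canonical zero = record
      { match = λ _ ()
      ; mismatch = subst₂ (λ i i′ → Mismatch t (y i) (y i′)) (sym (+-identityʳ i₀)) (sym (+-identityʳ i₀′)) mis₀
      ; iterated = λ j → trans (cong (R^ j) (+-identityʳ i₀)) (sym (+-identityʳ _))
      }
    canonical (suc k) = record
      { match = subst₂ (λ i i′ → Match i i′ M′) (R^-comm k i₀) (R^-comm k i₀′) (subst (Match (R I) (R I′)) M′-eq (proj₁ image))
      ; mismatch = subst₂ (λ i i′ → Mismatch t (y (i + M′)) (y (i′ + M′))) (R^-comm k i₀) (R^-comm k i₀′)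
          (subst (λ n → Mismatch t (y (R I + n)) (y (R I′ + n))) M′-eq (proj₂ image))
      ; iterated = λ j → subst (λ i → R^ j (i + M′) ≡ R^ j i + overhang t j (suc k)) (R^-comm k i₀) (begin
          R^ j (R I + M′)                              ≡⟨ cong (λ n → R^ j (R I + n)) (sym M′-eq) ⟩
          R^ j (R I + (span I M + t))                  ≡⟨ cong (R^ j) (sym (+-assoc (R I) _ t)) ⟩
          R^ j (R I + span I M + t)                    ≡⟨ cong (λ n → R^ j (n + t)) (sym (R-span I M)) ⟩
          R^ j (R (I + M) + t)                         ≡⟨ R^-tail j mismatch ⟩
          R^ (suc j) (I + M) + tailWeight t j          ≡⟨ cong (_+ tailWeight t j) (iterated (suc j)) ⟩
          R^ j (R I) + overhang t (suc j) k + tailWeight t j ≡⟨ +-assoc (R^ j (R I)) _ _ ⟩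
          R^ j (R I) + overhang t j (suc k)             ∎)
      }
      where
      open Canonical (canonical k)
      I = R^ k i₀
      I′ = R^ k i₀′
      M = overhang t 0 k
      M′ = overhang t 0 (suc k)
      image = Match-image-extended M match mismatch
      M′-eq : span I M + t ≡ M′
      M′-eq = cong₂ _+_ span-overhang (sym (tailWeight-zero mis₀))

  -- The stage is `suc k` since at stage 0 the canonical match is empty.
  record Inside (i i′ m : ℕ) : Set where
    constructor inside
    field
      {k i₀ i₀′ t offset} : ℕ
      i₀<i₀′   : i₀ < i₀′
      mismatch : Mismatch t (y i₀) (y i₀′)
      i-at     : i ≡ R^ (suc k) i₀ + offset
      i′-at    : i′ ≡ R^ (suc k) i₀′ + offset
      fits     : offset + m ≤ overhang t 0 (suc k)

  -- The match u, u′, m may be continued by t letters in the image only where it ends in a mismatch,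
  -- and inside a canonical match this happens only at its right end.
  Inside-image : ∀ {u u′ m r n} → Match u u′ m → Inside u u′ m →
    (r + n ≤ span u m ⊎ ∃[ t ] (Mismatch t (y (u + m)) (y (u′ + m)) × r + n ≤ span u m + t)) →
    Inside (R u + r) (R u′ + r) n
  Inside-image {u} {u′} {m} {r} {n} N (inside {k} {i₀} {i₀′} {t} {d} i₀<i₀′ mis refl refl fits) end =
    inside {k = suc k} i₀<i₀′ mis (at i₀ refl) (at i₀′ (sym (span-Match d (Match-≤ (≤-trans (m≤m+n d m) fits) match)))) fits′
    where
    open Canonical (canonical mis (suc k))
    I = R^ (suc k) i₀
    I′ = R^ (suc k) i₀′
    E = overhang t 0 (suc k)
    at : ∀ j → span (R^ (suc k) j) d ≡ span I d → R (R^ (suc k) j + d) + r ≡ R^ (suc (suc k)) j + (span I d + r)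
    at j eq = begin
      R (R^ (suc k) j + d) + r                          ≡⟨ cong (_+ r) (R-span (R^ (suc k) j) d) ⟩
      R (R^ (suc k) j) + span (R^ (suc k) j) d + r      ≡⟨ cong₂ (λ v s → v + s + r) (R^-comm (suc k) j) eq ⟩
      R^ (suc (suc k)) j + span I d + r                 ≡⟨ +-assoc _ (span I d) r ⟩
      R^ (suc (suc k)) j + (span I d + r)               ∎
    room : span I d + span (I + d) m ≤ overhang t 1 (suc k)
    room = subst₂ _≤_ (span-+ I d m) span-overhang (span-mono I fits)
    atEdge : ∀ {t′} → Mismatch t′ (y (I + d + m)) (y (I′ + d + m)) → t′ ≡ t
    atEdge {t′} mis′ with d + m ≟ E
    ... | yes eq = Mismatch-functional
          (subst₂ (λ j j′ → Mismatch t′ (y j) (y j′)) (trans (+-assoc I d m) (cong (I +_) eq)) (trans (+-assoc I′ d m) (cong (I′ +_) eq)) mis′)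
          mismatch
    ... | no neq = ⊥-elim (Mismatch-irrefl mis′
          (subst₂ (λ j j′ → y j ≡ y j′) (sym (+-assoc I d m)) (sym (+-assoc I′ d m)) (match (d + m) (≤∧≢⇒< fits neq))))
    fits′ : span I d + r + n ≤ overhang t 1 (suc k) + tailWeight t 0
    fits′ = subst (_≤ overhang t 1 (suc k) + tailWeight t 0) (sym (+-assoc (span I d) r n)) (bound end)
      where
      bound : (r + n ≤ span (I + d) m ⊎ ∃[ t′ ] (Mismatch t′ (y (I + d + m)) (y (I′ + d + m)) × r + n ≤ span (I + d) m + t′)) →
        span I d + (r + n) ≤ overhang t 1 (suc k) + tailWeight t 0
      bound (inj₁ le) = ≤-trans (+-monoʳ-≤ (span I d) le) (≤-trans room (m≤m+n _ _))
      bound (inj₂ (t′ , mis′ , le)) with atEdge mis′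
      ... | refl = ≤-trans (+-monoʳ-≤ (span I d) le)
                     (subst₂ _≤_ (+-assoc (span I d) _ t) (cong (overhang t 1 (suc k) +_) (sym (tailWeight-zero mis))) (+-monoˡ-≤ t room))

  -- Strong induction on the right position, bounded by `fuel`. The first matched letter fixes the
  -- offset in its block, so both positions have the same offset r; the match is prolonged left to
  -- the block starts and desubstituted. An empty preimage supplies the seed mismatch.
  Match⇒Inside : ∀ fuel i i′ m → i′ ≤ fuel → i < i′ → 1 ≤ m → Match i i′ m → Inside i i′ m
  Match⇒Inside zero i i′ m z≤n () _ _
  Match⇒Inside (suc fuel) i i′ (suc m) i′≤ i<i′ _ M with blockOf i | blockOf i′
  ... | u , r , r< , refl | u′ , r′ , r′< , refl
    with acb-injective (<-≤-trans r< (len≤3 (y u))) (<-≤-trans r′< (len≤3 (y u′)))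
           (trans (sym (y-block u r r<)) (trans (Match-head M) (y-block u′ r′ r′<)))
  ...   | refl = go (preimage (r + suc m) u u′ (r + suc m) ≤-refl (Match-++ blockStart M))
    where
    blockStart : Match (R u) (R u′) r
    blockStart j j<r = trans (y-block u j (<-trans j<r r<)) (sym (y-block u′ j (<-trans j<r r′<)))
    u<u′ : u < u′
    u<u′ = R-cancel-< (+-cancelʳ-< r (R u) (R u′) i<i′)
    u′≤fuel : u′ ≤ fuel
    u′≤fuel = ≤-pred (≤-trans (shrinks u<u′) i′≤)
      where
      -- u < u′ excludes u′ = 0, which `R` does not move.
      shrinks : ∀ {v} → u < v → v < R v + r
      shrinks {suc v} _ = ≤-trans (R-expands v) (m≤m+n _ _)
    go : Preimage u u′ (r + suc m) → Inside (R u + r) (R u′ + r) (suc m)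
    go (m′ , N , inj₁ (m′≥1 , q≤)) = Inside-image N (Match⇒Inside fuel u u′ m′ u′≤fuel u<u′ m′≥1 N) (inj₁ q≤)
    go (suc m′ , N , inj₂ end) = Inside-image N (Match⇒Inside fuel u u′ (suc m′) u′≤fuel u<u′ (s≤s z≤n) N) (inj₂ end)
    go (zero , N , inj₂ (t , mis , q≤)) = inside {k = 0} u<u′ mis₀ refl refl (subst (r + suc m ≤_) (sym (tailWeight-zero mis₀)) q≤)
      where
      mis₀ : Mismatch t (y u) (y u′)
      mis₀ = subst₂ (λ j j′ → Mismatch t (y j) (y j′)) (+-identityʳ u) (+-identityʳ u′) mis

  -- The cases even and odd are the extremal families; in the other two the exponent is at most 43/15.
  data Shape (p m : ℕ) : Set where
    even  : ∀ k → p ≡ X (suc k) → m ≤ overhang 1 0 (suc k) → Shape p m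
    even⁺ : ∀ k → Y (suc k) ≤ p → m ≤ overhang 1 0 (suc k) → Shape p m
    odd   : ∀ k → p ≡ Y (suc k) → m ≤ overhang 2 0 (suc k) → Shape p m
    odd⁺  : ∀ k → Z (suc k) ≤ p → m ≤ overhang 2 0 (suc k) → Shape p m

  R^-mono : ∀ k {u v} → u ≤ v → R^ k u ≤ R^ k v
  R^-mono zero u≤v = u≤v
  R^-mono (suc k) u≤v = R^-mono k (R-mono u≤v)

  X≤weight : ∀ k l → X k ≤ weight k l
  X≤weight k a = ≤-trans (X≤Y k) (Y≤Z k)
  X≤weight k b = X≤Y k
  X≤weight k c = ≤-refl

  -- Either the seeds are adjacent, or at least one more letter separates them, whose k-th image has
  -- length at least X k.
  weight≤period : ∀ k {u v p} → u < v → R^ k u + p ≡ R^ k v → p ≡ weight k (y u) ⊎ weight k (y u) + X k ≤ p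
  weight≤period k {u} {v} {p} u<v eq with suc u ≟ v
  ... | yes refl = inj₁ (+-cancelˡ-≡ (R^ k u) _ _ (trans eq (R^-suc k u)))
  ... | no neq = inj₂ (≤-trans (+-monoʳ-≤ (weight k (y u)) (X≤weight k (y (suc u))))
          (+-cancelˡ-≤ (R^ k u) _ _ (subst₂ _≤_
            (trans (R^-suc k (suc u)) (trans (cong (_+ weight k (y (suc u))) (R^-suc k u)) (+-assoc (R^ k u) _ _)))
            (sym eq) (R^-mono k (≤∧≢⇒< u<v neq)))))

  period-≥ : ∀ k {w p} → p ≡ w ⊎ w + X k ≤ p → w ≤ p
  period-≥ k (inj₁ refl) = ≤-refl
  period-≥ k (inj₂ le) = ≤-trans (m≤m+n _ _) le

  -- The left seed letter decides the period. Only adjacent seeds with c on the left, or b before a,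
  -- give an extremal family; farther apart, 2 X ≥ Y and Y + X ≥ Z lead to `even⁺` and `odd⁺`.
  Match⇒Shape : ∀ {i p m} → 1 ≤ p → 1 ≤ m → Match i (i + p) m → Shape p m
  Match⇒Shape {i} {p} {m} p≥1 m≥1 M = fromInside (Match⇒Inside (i + p) i (i + p) m ≤-refl (m<m+n i p≥1) m≥1 M)
    where
    fromInside : Inside i (i + p) m → Shape p m
    fromInside (inside {k} {i₀} {i₀′} {t} {d} i₀<i₀′ mis i-at i′-at fits) = classify mis refl
      where
      period : p ≡ weight (suc k) (y i₀) ⊎ weight (suc k) (y i₀) + X (suc k) ≤ p
      period = weight≤period (suc k) i₀<i₀′ (+-cancelʳ-≡ d _ _ (begin
        R^ (suc k) i₀ + p + d    ≡⟨ swap (R^ (suc k) i₀) p d ⟩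
        R^ (suc k) i₀ + d + p    ≡⟨ cong (_+ p) (sym i-at) ⟩
        i + p                    ≡⟨ i′-at ⟩
        R^ (suc k) i₀′ + d       ∎))
        where
        swap : ∀ u p d → u + p + d ≡ u + d + p
        swap = solve-∀
      m≤ : m ≤ overhang t 0 (suc k)
      m≤ = ≤-trans (m≤n+m m d) fits
      at : ∀ {l} → y i₀ ≡ l → p ≡ weight (suc k) l ⊎ weight (suc k) l + X (suc k) ≤ p
      at refl = period
      classify : ∀ {l l′} → Mismatch t l l′ → y i₀ ≡ l → Shape p m
      classify ab eq = odd⁺ k (period-≥ (suc k) (at eq)) m≤
      classify ba eq with at eq
      ... | inj₁ p≡ = odd k p≡ m≤
      ... | inj₂ p≥ = odd⁺ k (≤-trans (Z≤X+Y (suc k)) (subst (_≤ p) (+-comm (Y (suc k)) (X (suc k))) p≥)) m≤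
      classify ac eq = even⁺ k (≤-trans (Y≤Z (suc k)) (period-≥ (suc k) (at eq))) m≤
      classify bc eq = even⁺ k (period-≥ (suc k) (at eq)) m≤
      classify ca eq with at eq
      ... | inj₁ p≡ = even k p≡ m≤
      ... | inj₂ p≥ = even⁺ k (≤-trans (Y≤2X (suc k)) p≥) m≤
      classify cb eq with at eq
      ... | inj₁ p≡ = even k p≡ m≤
      ... | inj₂ p≥ = even⁺ k (≤-trans (Y≤2X (suc k)) p≥) m≤

  -- Short factors of the fixed point.

  data Follows : Letter → Letter → Set where
    aa : Follows a a
    ac : Follows a c
    ca : Follows c a
    cb : Follows c b
    ba : Follows b a

  follows : ∀ i → Follows (y i) (y (suc i))
  follows i with blockOf i
  ... | u , r , r< , refl = helper r (y u) refl r<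
    where
    next : ∀ r {l} → y u ≡ l → suc r < len l → y (suc (R u + r)) ≡ acb (suc r)
    next r eq r< = trans (cong y (sym (+-suc (R u) r))) (atOffset (suc r) eq r<)
    last : ∀ r {l} → y u ≡ l → suc r ≡ len l → y (suc (R u + r)) ≡ a
    last r eq r≡ = trans (cong y (trans (sym (+-suc (R u) r)) (cong (R u +_) r≡))) (atEnd eq)
    helper : ∀ r l → y u ≡ l → r < len (y u) → Follows (y (R u + r)) (y (suc (R u + r)))
    helper 0 a eq r< = subst₂ Follows (sym (y-block u 0 r<)) (sym (next 0 eq (s≤s (s≤s z≤n)))) ac
    helper 1 a eq r< = subst₂ Follows (sym (y-block u 1 r<)) (sym (next 1 eq ≤-refl)) cb
    helper 2 a eq r< = subst₂ Follows (sym (y-block u 2 r<)) (sym (last 2 eq refl)) ba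
    helper 0 b eq r< = subst₂ Follows (sym (y-block u 0 r<)) (sym (next 0 eq ≤-refl)) ac
    helper 1 b eq r< = subst₂ Follows (sym (y-block u 1 r<)) (sym (last 1 eq refl)) ca
    helper 0 c eq r< = subst₂ Follows (sym (y-block u 0 r<)) (sym (last 0 eq refl)) aa
    helper (suc (suc (suc r))) a eq r< = contradiction (subst (λ l → suc (suc (suc r)) < len l) eq r<) λ { (s≤s (s≤s (s≤s ()))) }
    helper (suc (suc r)) b eq r< = contradiction (subst (λ l → suc (suc r) < len l) eq r<) λ { (s≤s (s≤s ())) }
    helper (suc r) c eq r< = contradiction (subst (λ l → suc r < len l) eq r<) λ { (s≤s ()) }

  single-before-a : ∀ {u} → y (suc (R u)) ≡ a → y u ≡ c × suc (R u) ≡ R (suc u)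
  single-before-a {u} eq = helper (y u) refl
    where
    long : 1 < len (y u) → y u ≡ c × suc (R u) ≡ R (suc u)
    long 1< = contradiction (trans (sym (trans (cong y (+-comm 1 (R u))) (y-block u 1 1<))) eq) λ ()
    helper : ∀ l → y u ≡ l → y u ≡ c × suc (R u) ≡ R (suc u)
    helper a eq′ = long (subst (λ l → 1 < len l) (sym eq′) (s≤s (s≤s z≤n)))
    helper b eq′ = long (subst (λ l → 1 < len l) (sym eq′) ≤-refl)
    helper c eq′ = eq′ , sym (trans (R-suc u) (trans (cong (λ l → R u + len l) eq′) (+-comm (R u) 1)))

  -- Such a factor would start with two adjacent blocks of length 1, hence come from cc, which
  -- `Follows` excludes.
  no-aaa : ∀ i → y i ≡ a → y (suc i) ≡ a → y (suc (suc i)) ≢ a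
  no-aaa i eq₀ eq₁ eq₂ with blockOf i
  ... | u , r , r< , refl with acb-injective {r} {0} (<-≤-trans r< (len≤3 (y u))) (s≤s z≤n) (trans (sym (y-block u r r<)) eq₀)
  ...   | refl with single-before-a (subst (λ j → y (suc j) ≡ a) (+-identityʳ (R u)) eq₁)
  ...     | yu≡c , next with single-before-a (subst (λ j → y (suc j) ≡ a) (trans (cong suc (+-identityʳ (R u))) next) eq₂)
  ...       | ysu≡c , _ with subst₂ Follows yu≡c ysu≡c (follows u)
  ...         | ()

-- Counting preimages.

countBelow-hit : ∀ f {i} N → f N ≡ i → countBelow f i (suc N) ≡ suc (countBelow f i N)
countBelow-hit f {i} N eq with f N ≟ i
... | yes _ = refl
... | no neq = contradiction eq neq

countBelow-miss : ∀ f {i} N → f N ≢ i → countBelow f i (suc N) ≡ countBelow f i N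
countBelow-miss f {i} N neq with f N ≟ i
... | yes eq = contradiction eq neq
... | no _ = refl

countBelow-stable : ∀ f {i lo} o → (∀ k → lo ≤ k → f k ≢ i) → countBelow f i (o + lo) ≡ countBelow f i lo
countBelow-stable f zero misses = refl
countBelow-stable f {lo = lo} (suc o) misses =
  trans (countBelow-miss f (o + lo) (misses (o + lo) (m≤n+m lo o))) (countBelow-stable f o misses)

countBelow-none : ∀ f {i} N → (∀ k → k < N → f k ≢ i) → countBelow f i N ≡ 0
countBelow-none f zero misses = refl
countBelow-none f (suc N) misses =
  trans (countBelow-miss f N (misses N ≤-refl)) (countBelow-none f N (λ k k<N → misses k (m<n⇒m<1+n k<N)))

twos : Letter → ℕ
twos a = 2
twos b = 1
twos c = 1

-- The function H and the fixed point obtained from its increments.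

module Hofstadter
  (H : ℕ → ℕ) (H-zero : H 0 ≡ 0)
  (H-suc : ∀ i → H (suc i) ≡ suc i ∸ H (H (H i)))
  where

  open ≡-Reasoning

  K : ℕ → ℕ
  K i = H (H i)

  Step : (ℕ → ℕ) → ℕ → Set
  Step f i = f (suc i) ≡ f i ⊎ f (suc i) ≡ suc (f i)

  H≤ : ∀ i → H i ≤ i
  H≤ zero = ≤-reflexive H-zero
  H≤ (suc i) = subst (_≤ suc i) (sym (H-suc i)) (m∸n≤m (suc i) (H (H (H i))))

  Step-∘ : ∀ {f} i → Step f (H i) → Step H i → Step (λ j → f (H j)) i
  Step-∘ {f} i stepf (inj₁ eq) = inj₁ (cong f eq)
  Step-∘ {f} i (inj₁ eqf) (inj₂ eq) = inj₁ (trans (cong f eq) eqf)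
  Step-∘ {f} i (inj₂ eqf) (inj₂ eq) = inj₂ (trans (cong f eq) eqf)

  -- By the recurrence the increment of H at i + 1 is 1 minus that of H ∘ H ∘ H at i, and
  -- compositions of functions with increments 0 or 1 have such increments again. As H j ≤ j, only
  -- smaller arguments occur.
  H-step-below : ∀ n i → i < n → Step H i
  H-step-below (suc n) zero _ = inj₂ (begin
    H 1                    ≡⟨ H-suc 0 ⟩
    1 ∸ H (H (H 0))        ≡⟨ cong (1 ∸_) (trans (cong K H-zero) (trans (cong H H-zero) H-zero)) ⟩
    1                      ≡⟨ cong suc (sym H-zero) ⟩
    suc (H 0)              ∎)
  H-step-below (suc n) (suc i) (s≤s i<n) = conclude
    (Step-∘ {λ j → H (H j)} i (Step-∘ {H} (H i) (below (≤-trans (H≤ (H i)) (H≤ i))) (below (H≤ i))) (below ≤-refl))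
    where
    below : ∀ {j} → j ≤ i → Step H j
    below j≤i = H-step-below n _ (≤-<-trans j≤i i<n)
    conclude : Step (λ j → H (H (H j))) i → Step H (suc i)
    conclude (inj₁ eq) = inj₂ (begin
      H (suc (suc i))                            ≡⟨ H-suc (suc i) ⟩
      suc (suc i) ∸ H (H (H (suc i)))            ≡⟨ cong (suc (suc i) ∸_) eq ⟩
      suc (suc i) ∸ H (H (H i))                  ≡⟨ +-∸-assoc 1 (≤-trans (H≤ (H (H i))) (≤-trans (H≤ (H i)) (≤-trans (H≤ i) (n≤1+n i)))) ⟩
      suc (suc i ∸ H (H (H i)))                  ≡⟨ cong suc (sym (H-suc i)) ⟩
      suc (H (suc i))                            ∎)
    conclude (inj₂ eq) = inj₁ (begin
      H (suc (suc i))                            ≡⟨ H-suc (suc i) ⟩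
      suc (suc i) ∸ H (H (H (suc i)))            ≡⟨ cong (suc (suc i) ∸_) eq ⟩
      suc i ∸ H (H (H i))                        ≡⟨ sym (H-suc i) ⟩
      H (suc i)                                  ∎)

  H-step : ∀ i → Step H i
  H-step i = H-step-below (suc i) i ≤-refl

  K-step : ∀ i → Step K i
  K-step i = Step-∘ {H} i (H-step (H i)) (H-step i)

  H-mono : ∀ {i j} → i ≤ j → H i ≤ H j
  H-mono {i} i≤j with m≤n⇒∃[o]m+o≡n i≤j
  ... | o , refl = subst (λ n → H i ≤ H n) (+-comm o i) (go o)
    where
    go : ∀ o → H i ≤ H (o + i)
    go zero = ≤-refl
    go (suc o) with H-step (o + i)
    ... | inj₁ eq = ≤-trans (go o) (≤-reflexive (sym eq))
    ... | inj₂ eq = ≤-trans (go o) (≤-trans (n≤1+n _) (≤-reflexive (sym eq)))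

  -- P i is the last argument at which H takes the value i.
  P : ℕ → ℕ
  P i = i + K i

  -- Letters record the increments of H and K; H flat forces K flat, which leaves three of the four
  -- combinations.
  data Kind (i : ℕ) : Letter → Set where
    a : K (suc i) ≡ suc (K i) → H (suc i) ≡ suc (H i) → Kind i a
    b : K (suc i) ≡ K i → H (suc i) ≡ suc (H i) → Kind i b
    c : K (suc i) ≡ K i → H (suc i) ≡ H i → Kind i c

  kind : ∀ i → ∃ (Kind i)
  kind i with H-step i | K-step i
  ... | inj₁ h | _      = c , c (cong H h) h
  ... | inj₂ h | inj₁ k = b , b k h
  ... | inj₂ h | inj₂ k = a , a k h

  y : ℕ → Letter
  y i = proj₁ (kind i)

  Kind-unique : ∀ {i l l′} → Kind i l → Kind i l′ → l ≡ l′
  Kind-unique (a _ _) (a _ _) = refl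
  Kind-unique (b _ _) (b _ _) = refl
  Kind-unique (c _ _) (c _ _) = refl
  Kind-unique (a k _) (b k′ _) = contradiction (trans (sym k) k′) 1+n≢n
  Kind-unique (a k _) (c k′ _) = contradiction (trans (sym k) k′) 1+n≢n
  Kind-unique (b k _) (a k′ _) = contradiction (trans (sym k′) k) 1+n≢n
  Kind-unique (b _ h) (c _ h′) = contradiction (trans (sym h) h′) 1+n≢n
  Kind-unique (c k _) (a k′ _) = contradiction (trans (sym k′) k) 1+n≢n
  Kind-unique (c _ h) (b _ h′) = contradiction (trans (sym h′) h) 1+n≢n

  y-kind : ∀ {i l} → Kind i l → y i ≡ l
  y-kind {i} = Kind-unique (proj₂ (kind i))

  P-suc : ∀ i → P (suc i) ≡ P i + twos (y i)
  P-suc i = helper (proj₂ (kind i))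
    where
    stays : K (suc i) ≡ K i → P (suc i) ≡ P i + 1
    stays k = trans (cong (suc i +_) k) (+-comm 1 (i + K i))
    helper : ∀ {l} → Kind i l → P (suc i) ≡ P i + twos l
    helper (a k h) = trans (cong (suc i +_) k) (trans (+-suc (suc i) (K i)) (+-comm 2 (i + K i)))
    helper (b k h) = stays k
    helper (c k h) = stays k

  H-P⇒H-suc-P : ∀ i → H (P i) ≡ i → H (suc (P i)) ≡ suc i
  H-P⇒H-suc-P i eq = begin
    H (suc (P i))                   ≡⟨ H-suc (P i) ⟩
    suc (P i) ∸ H (H (H (P i)))     ≡⟨ cong (λ j → suc (P i) ∸ K j) eq ⟩
    suc (i + K i) ∸ K i             ≡⟨ m+n∸n≡m (suc i) (K i) ⟩
    suc i                           ∎

  -- P (i + 1) exceeds P i by 1 or 2 according to the increment of K, and the recurrence is unfolded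
  -- as many times.
  H-P : ∀ i → H (P i) ≡ i
  H-P zero = trans (cong H (trans (cong H H-zero) H-zero)) H-zero
  H-P (suc i) with K-step i
  ... | inj₁ k = trans (cong (λ j → H (suc i + j)) k) (H-P⇒H-suc-P i (H-P i))
  ... | inj₂ k = begin
    H (suc i + K (suc i))                     ≡⟨ cong (λ j → H (suc i + j)) k ⟩
    H (suc i + suc (K i))                     ≡⟨ cong H (+-suc (suc i) (K i)) ⟩
    H (suc (suc (P i)))                       ≡⟨ H-suc (suc (P i)) ⟩
    suc (suc (P i)) ∸ H (H (H (suc (P i))))   ≡⟨ cong (λ j → suc (suc (P i)) ∸ K j) (H-P⇒H-suc-P i (H-P i)) ⟩
    suc (suc (P i)) ∸ K (suc i)               ≡⟨ cong (suc (suc (P i)) ∸_) k ⟩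
    suc (i + K i) ∸ K i                       ≡⟨ m+n∸n≡m (suc i) (K i) ⟩
    suc i                                     ∎

  H-suc-P : ∀ i → H (suc (P i)) ≡ suc i
  H-suc-P i = H-P⇒H-suc-P i (H-P i)

  P-steps-H : ∀ i → H (suc (P i)) ≡ suc (H (P i))
  P-steps-H i = trans (H-suc-P i) (cong suc (sym (H-P i)))

  -- P realises the unsquared morphism a ↦ ac, b ↦ a, c ↦ b: `Kind-P-a`, `Kind-P-b` and `Kind-suc-P`
  -- read off its images. Squaring it yields the blocks of R.
  Kind-P-a : ∀ {i} → H (suc i) ≡ suc (H i) → Kind (P i) a
  Kind-P-a {i} h = a (trans (cong H (H-suc-P i)) (trans h (cong (λ j → suc (H j)) (sym (H-P i))))) (P-steps-H i)

  Kind-P-b : ∀ {i} → H (suc i) ≡ H i → Kind (P i) b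
  Kind-P-b {i} h = b (trans (cong H (H-suc-P i)) (trans h (cong H (sym (H-P i))))) (P-steps-H i)

  Kind-suc-P : ∀ {i} → y i ≡ a → Kind (suc (P i)) c
  Kind-suc-P {i} eq = c (cong H flat) flat
    where
    flat : H (suc (suc (P i))) ≡ H (suc (P i))
    flat = trans (cong H (trans (+-comm 2 (P i)) (trans (cong (λ l → P i + twos l) (sym eq)) (sym (P-suc i)))))
             (trans (H-P (suc i)) (sym (H-suc-P i)))

  R : ℕ → ℕ
  R u = P (P u)

  P-suc-at : ∀ {i l} → Kind i l → P (suc i) ≡ P i + twos l
  P-suc-at {i} κ = trans (P-suc i) (cong (λ l → P i + twos l) (y-kind κ))

  R-suc : ∀ u → R (suc u) ≡ R u + len (y u)
  R-suc u = helper (proj₂ (kind u))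
    where
    stays : ∀ {l} → P (suc u) ≡ P u + 1 → Kind (P u) l → R (suc u) ≡ R u + twos l
    stays P≡ κ = trans (cong P (trans P≡ (+-comm (P u) 1))) (P-suc-at κ)
    helper : ∀ {l} → Kind u l → R (suc u) ≡ R u + len l
    helper κ@(a k h) = begin
      P (P (suc u))          ≡⟨ cong P (trans (P-suc-at κ) (+-comm (P u) 2)) ⟩
      P (suc (suc (P u)))    ≡⟨ P-suc-at (Kind-suc-P (y-kind κ)) ⟩
      P (suc (P u)) + 1      ≡⟨ cong (_+ 1) (P-suc-at (Kind-P-a h)) ⟩
      R u + 2 + 1            ≡⟨ +-assoc (R u) 2 1 ⟩
      R u + 3                ∎
    helper κ@(b k h) = stays (P-suc-at κ) (Kind-P-a h)
    helper κ@(c k h) = stays (P-suc-at κ) (Kind-P-b h)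

  y-block : ∀ u r → r < len (y u) → y (R u + r) ≡ acb r
  y-block u 0 _ = trans (cong y (+-identityʳ (R u))) (y-kind (Kind-P-a (P-steps-H u)))
  y-block u 1 r< = trans (cong y (+-comm (R u) 1)) (y-kind (Kind-suc-P {P u} (helper (proj₂ (kind u)) r<)))
    where
    helper : ∀ {l} → Kind u l → 1 < len l → y (P u) ≡ a
    helper (a k h) _ = y-kind (Kind-P-a h)
    helper (b k h) _ = y-kind (Kind-P-a h)
    helper (c k h) (s≤s ())
  y-block u 2 r< = helper (proj₂ (kind u)) r<
    where
    helper : ∀ {l} → Kind u l → 2 < len l → y (R u + 2) ≡ b
    helper (b k h) (s≤s (s≤s ()))
    helper (c k h) (s≤s ())
    helper κ@(a k h) _ = trans (cong y (sym (P-suc-at (Kind-P-a h)))) (y-kind (Kind-P-b flat))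
      where
      flat : H (suc (suc (P u))) ≡ H (suc (P u))
      flat with Kind-suc-P (y-kind κ)
      ... | c _ h′ = h′
  y-block u (suc (suc (suc r))) r< = contradiction (<-≤-trans r< (len≤3 (y u))) λ { (s≤s (s≤s (s≤s ()))) }

  R-zero : R 0 ≡ 0
  R-zero = trans (cong P P0) P0
    where
    P0 : P 0 ≡ 0
    P0 = trans (cong H H-zero) H-zero

  module _ (S : ℕ → ℕ) (S-count : ∀ i → ∃[ N ] ((∀ k → H k ≡ i → k < N) × S i ≡ countBelow H i N)) where

    -- H is monotone, so nothing past `last` counts and the choice of N does not matter.
    countBelow-all : ∀ {i last} → H last ≡ i → H (suc last) ≡ suc i → S i ≡ suc (countBelow H i last)
    countBelow-all {i} {last} hit next with S-count i
    ... | N , bounds , eq with m≤n⇒∃[o]m+o≡n (bounds last hit)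
    ...   | o , refl = begin
      S i                                ≡⟨ eq ⟩
      countBelow H i (suc last + o)      ≡⟨ cong (countBelow H i) (+-comm (suc last) o) ⟩
      countBelow H i (o + suc last)      ≡⟨ countBelow-stable H o (λ k last<k Hk≡i → <⇒≱ (subst₂ _<_ refl (sym next) ≤-refl)
                                              (≤-trans (H-mono last<k) (≤-reflexive Hk≡i))) ⟩
      countBelow H i (suc last)          ≡⟨ countBelow-hit H last hit ⟩
      suc (countBelow H i last)          ∎

    S-zero : S 0 ≡ 1
    S-zero = trans (countBelow-all {0} {0} H-zero H-one) refl
      where
      H-one : H 1 ≡ 1
      H-one = subst (λ i → H (suc i) ≡ 1) (trans (cong H H-zero) H-zero) (H-suc-P 0)

    -- The arguments with value i + 1 are those in the interval from P i + 1 to P (i + 1).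
    S-suc : ∀ i → S (suc i) ≡ twos (y i)
    S-suc i = trans (countBelow-all (H-P (suc i)) (H-suc-P (suc i))) (helper (proj₂ (kind i)))
      where
      none : countBelow H (suc i) (suc (P i)) ≡ 0
      none = countBelow-none H (suc (P i)) (λ k k≤Pi Hk≡ →
        1+n≰n (≤-trans (≤-reflexive (sym Hk≡)) (≤-trans (H-mono (≤-pred k≤Pi)) (≤-reflexive (H-P i)))))
      single : P (suc i) ≡ P i + 1 → suc (countBelow H (suc i) (P (suc i))) ≡ 1
      single eq = cong suc (trans (cong (countBelow H (suc i)) (trans eq (+-comm (P i) 1))) none)
      helper : ∀ {l} → Kind i l → suc (countBelow H (suc i) (P (suc i))) ≡ twos l
      helper κ@(a k h) = cong suc (trans (cong (countBelow H (suc i)) (trans (P-suc-at κ) (+-comm (P i) 2)))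
        (trans (countBelow-hit H (suc (P i)) (H-suc-P i)) (cong suc none)))
      helper κ@(b k h) = single (P-suc-at κ)
      helper κ@(c k h) = single (P-suc-at κ)

-- Exponent bounds for the families of repetitions.

open import Data.Integer as ℤ using (+_; +≤+)
import Data.Integer.Properties as ℤₚ

-- The start is evaluated; raising n by one advances two Narayana indices. Smaller indices are
-- evaluated directly in `tight-even` and `tight-odd`.
balanced-odd : ∀ n → Balanced (+ Y (8 + n)) (+ Z (8 + n)) (+ Z (8 + n) ℤ.+ + X (8 + n))
balanced-odd zero = record
  { x≥4 = +≤+ z≤n ; x≤y = +≤+ z≤n ; y≤z = +≤+ z≤n ; y≤2x = +≤+ z≤n ; z≤2y = +≤+ z≤n ; z≤3x = +≤+ z≤n
  ; w₀≥4 = +≤+ z≤n ; w₁≥4 = +≤+ z≤n ; w₂≥4 = +≤+ z≤n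
  ; d₀≤ = +≤+ z≤n ; -d₀≤ = +≤+ z≤n ; d₁≤ = +≤+ z≤n ; -d₁≤ = +≤+ z≤n ; d₂≤ = +≤+ z≤n ; -d₂≤ = +≤+ z≤n }
balanced-odd (suc n) = Balanced-step (Balanced-step (balanced-odd n))

balanced-even : ∀ n → Balanced (+ X (9 + n)) (+ Y (9 + n)) (+ Z (9 + n))
balanced-even n = Balanced-step (balanced-odd n)

-- X 1 is left out: the deficit there is 9 - 18. Period 1 is handled by `no-cube` instead.
tight-even : ∀ n → Tight (+ X (2 + n)) (+ Y (2 + n)) (+ Z (2 + n))
tight-even 0 = tight (+≤+ z≤n) (+≤+ z≤n)
tight-even 1 = tight (+≤+ z≤n) (+≤+ z≤n)
tight-even 2 = tight (+≤+ z≤n) (+≤+ z≤n)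
tight-even 3 = tight (+≤+ z≤n) (+≤+ z≤n)
tight-even 4 = tight (+≤+ z≤n) (+≤+ z≤n)
tight-even 5 = tight (+≤+ z≤n) (+≤+ z≤n)
tight-even 6 = tight (+≤+ z≤n) (+≤+ z≤n)
tight-even (suc (suc (suc (suc (suc (suc (suc n))))))) = Balanced⇒Tight (balanced-even n)

tight-odd : ∀ n → Tight (+ Y (1 + n)) (+ Z (1 + n)) (+ (Z (1 + n) + X (1 + n)))
tight-odd 0 = tight (+≤+ z≤n) (+≤+ z≤n)
tight-odd 1 = tight (+≤+ z≤n) (+≤+ z≤n)
tight-odd 2 = tight (+≤+ z≤n) (+≤+ z≤n)
tight-odd 3 = tight (+≤+ z≤n) (+≤+ z≤n)
tight-odd 4 = tight (+≤+ z≤n) (+≤+ z≤n)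
tight-odd 5 = tight (+≤+ z≤n) (+≤+ z≤n)
tight-odd 6 = tight (+≤+ z≤n) (+≤+ z≤n)
tight-odd (suc (suc (suc (suc (suc (suc (suc n))))))) = Balanced⇒Tight (balanced-odd n)

overhang₁-sum : ∀ k → 3 * overhang 1 0 k + 4 ≡ Z k + Y k + 2 * X k
overhang₁-sum k = trans (overhang₁ k 0) (cong (λ n → Z n + Y n + 2 * X n) (+-identityʳ k))

overhang₂-sum : ∀ k → 3 * overhang 2 0 k + 5 ≡ X k + 2 * Z k + 2 * Y k
overhang₂-sum k = trans (overhang₂ k 0) (cong (λ n → X n + 2 * Z n + 2 * Y n) (+-identityʳ k))

-- The extra 1 in the length p + 1 + m pays for the letter left of a match that the coding of S hides.
even-bound : ∀ k {m} → m ≤ overhang 1 0 (2 + k) → RatAtMostC (X (2 + k) + suc m) (X (2 + k))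
even-bound k {m} m≤ = Tight⇒RatAtMostC (x + suc m) (tight-even k) (begin
  3 * (x + suc m) + 1                    ≡⟨ lhs x m ⟩
  3 * x + (3 * m + 4)                    ≤⟨ +-monoʳ-≤ (3 * x) (+-monoˡ-≤ 4 (*-monoʳ-≤ 3 m≤)) ⟩
  3 * x + (3 * overhang 1 0 (2 + k) + 4) ≡⟨ cong (_+_ (3 * x)) (overhang₁-sum (2 + k)) ⟩
  3 * x + (Z (2 + k) + Y (2 + k) + 2 * x) ≡⟨ rhs x (Y (2 + k)) (Z (2 + k)) ⟩
  5 * x + Y (2 + k) + Z (2 + k)          ∎)
  where
  open ≤-Reasoning
  x = X (2 + k)
  lhs : ∀ x m → 3 * (x + suc m) + 1 ≡ 3 * x + (3 * m + 4)
  lhs = solve-∀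
  rhs : ∀ x y z → 3 * x + (z + y + 2 * x) ≡ 5 * x + y + z
  rhs = solve-∀

odd-bound : ∀ k {m} → m ≤ overhang 2 0 (1 + k) → RatAtMostC (Y (1 + k) + suc m) (Y (1 + k))
odd-bound k {m} m≤ = Tight⇒RatAtMostC (y + suc m) (tight-odd k) (begin
  -- The constant 5 of `overhang₂-sum`, against 4 in the even family, leaves one unit to spare.
  3 * (y + suc m) + 1                    ≤⟨ n≤1+n _ ⟩
  suc (3 * (y + suc m) + 1)              ≡⟨ lhs y m ⟩
  3 * y + (3 * m + 5)                    ≤⟨ +-monoʳ-≤ (3 * y) (+-monoˡ-≤ 5 (*-monoʳ-≤ 3 m≤)) ⟩
  3 * y + (3 * overhang 2 0 (1 + k) + 5) ≡⟨ cong (_+_ (3 * y)) (overhang₂-sum (1 + k)) ⟩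
  3 * y + (X (1 + k) + 2 * Z (1 + k) + 2 * y) ≡⟨ rhs (X (1 + k)) y (Z (1 + k)) ⟩
  5 * y + Z (1 + k) + (Z (1 + k) + X (1 + k)) ∎)
  where
  open ≤-Reasoning
  y = Y (1 + k)
  lhs : ∀ y m → suc (3 * (y + suc m) + 1) ≡ 3 * y + (3 * m + 5)
  lhs = solve-∀
  rhs : ∀ x y z → 3 * y + (x + 2 * z + 2 * y) ≡ 5 * y + z + (z + x)
  rhs = solve-∀

15m+15≤28p⇒RatAtMostC : ∀ p m → 15 * m + 15 ≤ 28 * p → RatAtMostC (p + suc m) p
15m+15≤28p⇒RatAtMostC p m le = 15n≤43p⇒RatAtMostC (p + suc m) p
  (subst₂ _≤_ (lhs p m) (sym (*-distribʳ-+ p 15 28)) (+-monoʳ-≤ (15 * p) le))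
  where
  lhs : ∀ p m → 15 * p + (15 * m + 15) ≡ 15 * (p + suc m)
  lhs = solve-∀

-- Z + Y + 2 X ≤ 5 Y bounds m + 1 by 5/3 of the period, below 28/15 = 43/15 - 1. `odd⁺-bound` has
-- the same margin.
even⁺-bound : ∀ k {p m} → Y k ≤ p → m ≤ overhang 1 0 k → RatAtMostC (p + suc m) p
even⁺-bound k {p} {m} y≤p m≤ = 15m+15≤28p⇒RatAtMostC p m (begin
  15 * m + 15                    ≤⟨ +-mono-≤ (*-monoʳ-≤ 15 m≤) (m≤m+n 15 5) ⟩
  15 * o + 20                    ≡⟨ factor o ⟩
  5 * (3 * o + 4)                ≡⟨ cong (_*_ 5) (overhang₁-sum k) ⟩
  5 * (Z k + Y k + 2 * X k)      ≤⟨ *-monoʳ-≤ 5 (+-mono-≤ (+-monoˡ-≤ (Y k) (≤-trans (Z≤X+Y k) (+-monoˡ-≤ (Y k) (X≤Y k)))) (*-monoʳ-≤ 2 (X≤Y k))) ⟩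
  5 * (Y k + Y k + Y k + 2 * Y k) ≡⟨ collect (Y k) ⟩
  25 * Y k                       ≤⟨ *-mono-≤ (m≤m+n 25 3) y≤p ⟩
  28 * p                         ∎)
  where
  open ≤-Reasoning
  o = overhang 1 0 k
  factor : ∀ o → 15 * o + 20 ≡ 5 * (3 * o + 4)
  factor = solve-∀
  collect : ∀ y → 5 * (y + y + y + 2 * y) ≡ 25 * y
  collect = solve-∀

odd⁺-bound : ∀ k {p m} → Z k ≤ p → m ≤ overhang 2 0 k → RatAtMostC (p + suc m) p
odd⁺-bound k {p} {m} z≤p m≤ = 15m+15≤28p⇒RatAtMostC p m (begin
  15 * m + 15                    ≤⟨ +-mono-≤ (*-monoʳ-≤ 15 m≤) (m≤m+n 15 10) ⟩
  15 * o + 25                    ≡⟨ factor o ⟩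
  5 * (3 * o + 5)                ≡⟨ cong (_*_ 5) (overhang₂-sum k) ⟩
  5 * (X k + 2 * Z k + 2 * Y k)  ≤⟨ *-monoʳ-≤ 5 (+-mono-≤ (+-monoˡ-≤ (2 * Z k) (≤-trans (X≤Y k) (Y≤Z k))) (*-monoʳ-≤ 2 (Y≤Z k))) ⟩
  5 * (Z k + 2 * Z k + 2 * Z k)  ≡⟨ collect (Z k) ⟩
  25 * Z k                       ≤⟨ *-mono-≤ (m≤m+n 25 3) z≤p ⟩
  28 * p                         ∎)
  where
  open ≤-Reasoning
  o = overhang 2 0 k
  factor : ∀ o → 15 * o + 25 ≡ 5 * (3 * o + 5)
  factor = solve-∀
  collect : ∀ z → 5 * (z + 2 * z + 2 * z) ≡ 25 * z
  collect = solve-∀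

-- If r / s were at least (x + o) / x, `RatBelowC⇒small` would give 9 x³ ≤ 203 s³ x², against 203 s³
-- < x.
balanced-beats : ∀ {x y z o} r s → Balanced (+ x) (+ y) (+ z) → 3 * o + 4 ≡ z + y + 2 * x →
  203 * (s * s * s) < x → RatBelowC r s → r * x < (x + o) * s
balanced-beats {x} {y} {z} {o} r s B o-sum e<x below with r * x <? (x + o) * s
... | yes lt = lt
... | no nlt = contradiction small (<⇒≱ large)
  where
  e = 203 * (s * s * s)
  n = x + o
  length-sum : 3 * n + 4 ≡ 5 * x + y + z
  length-sum = trans (regroup x o) (trans (cong (_+_ (3 * x)) o-sum) (rhs x y z))
    where
    regroup : ∀ x o → 3 * (x + o) + 4 ≡ 3 * x + (3 * o + 4)
    regroup = solve-∀
    rhs : ∀ x y z → 3 * x + (z + y + 2 * x) ≡ 5 * x + y + z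
    rhs = solve-∀
  length-sumℤ : + 3 ℤ.* + n ℤ.+ + 4 ≡ + 5 ℤ.* + x ℤ.+ + y ℤ.+ + z
  length-sumℤ = trans (cong (λ i → i ℤ.+ + 4) (sym (ℤₚ.pos-* 3 n))) (trans (cong +_ length-sum)
    (cong (λ i → i ℤ.+ + y ℤ.+ + z) (ℤₚ.pos-* 5 x)))
  small-ℤ : NonNeg (+ 203 ℤ.* (+ s ℤ.* + s ℤ.* + s) ℤ.* (+ x ℤ.* + x) ℤ.- + 9 ℤ.* (+ x ℤ.* + x ℤ.* + x))
  small-ℤ = RatBelowC⇒small B {a = + r} {b = + s} {n = + n} length-sumℤ
    (nat s) (RatBelowC⇒cubicGap≥1 r s below)
    (ℤₚ.i≤j⇒0≤j-i (subst₂ ℤ._≤_ (ℤₚ.pos-* n s) (ℤₚ.pos-* r x) (+≤+ (≮⇒≥ nlt))))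
  pos-cube : ∀ i → + (i * i * i) ≡ + i ℤ.* + i ℤ.* + i
  pos-cube i = trans (ℤₚ.pos-* (i * i) i) (cong (λ j → j ℤ.* + i) (ℤₚ.pos-* i i))
  small : 9 * (x * x * x) ≤ e * (x * x)
  small = ℤₚ.drop‿+≤+ (subst₂ ℤ._≤_
    (sym (trans (ℤₚ.pos-* 9 (x * x * x)) (cong (λ i → + 9 ℤ.* i) (pos-cube x))))
    (sym (trans (ℤₚ.pos-* e (x * x)) (cong₂ ℤ._*_
      (trans (ℤₚ.pos-* 203 (s * s * s)) (cong (λ i → + 203 ℤ.* i) (pos-cube s)))
      (ℤₚ.pos-* x x))))
    (ℤₚ.0≤i-j⇒j≤i small-ℤ))
  x≥1 : 1 ≤ x
  x≥1 = ≤-<-trans z≤n e<x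
  large : e * (x * x) < 9 * (x * x * x)
  large = <-≤-trans (*-monoˡ-< (x * x) {{>-nonZero (*-mono-≤ x≥1 x≥1)}} e<x)
    (≤-trans (≤-reflexive (sym (*-assoc x x x))) (m≤m+n _ _))

-- Least periods.

least : ∀ {P : ℕ → Set} → (∀ q → Dec (P q)) → ∀ p → P p → ∃[ q ] (q ≤ p × P q × (∀ r → r < q → ¬ P r))
least P? p Pp with P? 0
... | yes P0 = 0 , z≤n , P0 , λ _ ()
least P? zero Pp | no ¬P0 = contradiction Pp ¬P0
least P? (suc p) Pp | no ¬P0 with least (λ q → P? (suc q)) p Pp
... | q , q≤p , Pq , below = suc q , s≤s q≤p , Pq , λ { zero _ → ¬P0 ; (suc r) (s≤s r<q) → below r r<q }

HasPeriod? : ∀ x i n p → Dec (HasPeriod x i n p)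
HasPeriod? x i n p with 1 ≤? p | p ≤? n
... | no 1≰p  | _       = no λ per → 1≰p (proj₁ per)
... | yes _   | no p≰n  = no λ per → p≰n (proj₁ (proj₂ per))
... | yes 1≤p | yes p≤n = map′
  (λ f → 1≤p , p≤n , λ j j+p<n → f (m+n≤o⇒m≤o∸n (suc j) j+p<n))
  (λ per {j} j<n∸p → proj₂ (proj₂ per) j (m≤o∸n⇒m+n≤o (suc j) p≤n j<n∸p))
  (allUpTo? (λ j → x (i + j) ≟ x (i + j + p)) (n ∸ p))

-- Passing to the least period can only raise the exponent, so the lower bound may exhibit any
-- period.
HasPeriod⇒MinPeriod : ∀ x i n {p} → HasPeriod x i n p → ∃[ q ] (q ≤ p × MinPeriod x i n q)
HasPeriod⇒MinPeriod x i n {p} per with least (HasPeriod? x i n) p per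
... | q , q≤p , per′ , min = q , q≤p , per′ , min

-- Transfer between the fixed point and its coding S.

twos≡2⇒a : ∀ {l} → twos l ≡ 2 → l ≡ a
twos≡2⇒a {a} _ = refl
twos≡2⇒a {b} ()
twos≡2⇒a {c} ()

module Coding
  (y : ℕ → Letter) (R : ℕ → ℕ)
  (R-zero : R 0 ≡ 0)
  (R-suc : ∀ u → R (suc u) ≡ R u + len (y u))
  (y-block : ∀ u r → r < len (y u) → y (R u + r) ≡ acb r)
  (S : ℕ → ℕ) (S-zero : S 0 ≡ 1) (S-suc : ∀ i → S (suc i) ≡ twos (y i))
  where

  open FixedPoint y R R-zero R-suc y-block

  -- A letter coded 1 is b after code 1 and c after code 2; code 2 is always a.
  Follows-determined : ∀ {l₁ l₂ k₁ k₂} → Follows l₁ l₂ → Follows k₁ k₂ → twos l₁ ≡ twos k₁ → twos l₂ ≡ twos k₂ → l₂ ≡ k₂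
  Follows-determined aa aa _ _ = refl
  Follows-determined aa ca () _
  Follows-determined aa ba () _
  Follows-determined aa ac _ ()
  Follows-determined aa cb () _
  Follows-determined ac ac _ _ = refl
  Follows-determined ac aa _ ()
  Follows-determined ac ca () _
  Follows-determined ac cb () _
  Follows-determined ac ba () _
  Follows-determined ca ca _ _ = refl
  Follows-determined ca ba _ _ = refl
  Follows-determined ca aa () _
  Follows-determined ca ac () _
  Follows-determined ca cb _ ()
  Follows-determined cb cb _ _ = refl
  Follows-determined cb aa () _
  Follows-determined cb ac () _
  Follows-determined cb ca _ ()
  Follows-determined cb ba _ ()
  Follows-determined ba ba _ _ = refl
  Follows-determined ba ca _ _ = refl
  Follows-determined ba aa () _
  Follows-determined ba ac () _
  Follows-determined ba cb _ ()

  letter-determined : ∀ q p → S q ≡ S (q + p) → S (suc q) ≡ S (suc (q + p)) → y q ≡ y (q + p)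
  -- `S 0` codes no letter, but y 0 = a is coded 2, which identifies the other letter as well.
  letter-determined zero p _ eq = trans y0≡a (sym (twos≡2⇒a (trans (sym (S-suc p)) (trans (sym eq) (trans (S-suc 0) (cong twos y0≡a))))))
  letter-determined (suc q) p eq₀ eq₁ = Follows-determined (follows q) (follows (q + p))
    (trans (sym (S-suc q)) (trans eq₀ (S-suc (q + p))))
    (trans (sym (S-suc (suc q))) (trans eq₁ (S-suc (suc (q + p)))))

  -- Each letter is recovered from two consecutive codes, so excess m + 1 in S gives only m matched
  -- letters.
  period⇒Match : ∀ {i p m} → (∀ j → j + p < p + suc m → S (i + j) ≡ S (i + j + p)) → Match i (i + p) m
  period⇒Match {i} {p} {m} per j j<m = trans
    (letter-determined (i + j) p (per j (bound (m<n⇒m<1+n j<m)))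
      (subst (λ q → S q ≡ S (q + p)) (+-suc i j) (per (suc j) (bound (s≤s j<m)))))
    (cong y (swap i j p))
    where
    bound : ∀ {j} → j < suc m → j + p < p + suc m
    bound {j} j< = subst (_< p + suc m) (+-comm p j) (+-monoʳ-< p j<)
    swap : ∀ i j p → i + j + p ≡ i + p + j
    swap = solve-∀

  -- Equal neighbours must be aa; then S i = 2, so a further a precedes them, against `no-aaa`. At i
  -- = 0 the value S 0 = 1 contradicts this.
  no-cube : ∀ i → S i ≡ S (suc i) → y i ≢ y (suc i)
  no-cube i eq₀ eq₁ with y i in yi | y (suc i) in ysi | follows i
  ... | .a | .a | aa = helper i yi ysi eq₀
    where
    helper : ∀ i → y i ≡ a → y (suc i) ≡ a → S i ≡ S (suc i) → ⊥
    helper zero y0 _ eq = contradiction (trans (sym S-zero) (trans eq (trans (S-suc 0) (cong twos y0)))) λ ()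
    helper (suc i) y₁ y₂ eq =
      no-aaa i (twos≡2⇒a (trans (sym (S-suc i)) (trans eq (trans (S-suc (suc i)) (cong twos y₁))))) y₁ y₂
  no-cube i eq₀ () | .a | .c | ac
  no-cube i eq₀ () | .c | .a | ca
  no-cube i eq₀ () | .c | .b | cb
  no-cube i eq₀ () | .b | .a | ba

  exponent≤c : ∀ i n p → HasPeriod S i n p → RatAtMostC n p
  exponent≤c i n p (p≥1 , p≤n , per) with m≤n⇒∃[o]m+o≡n p≤n
  -- With excess 0 or 1 no letter can be recovered, but the exponent is at most 2.
  ... | 0 , refl = 15n≤43p⇒RatAtMostC (p + 0) p
        (*-mono-≤ (m≤m+n 15 28) (≤-reflexive (+-identityʳ p)))
  ... | 1 , refl = 15n≤43p⇒RatAtMostC (p + 1) p (begin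
        15 * (p + 1)   ≤⟨ *-monoʳ-≤ 15 (+-monoʳ-≤ p p≥1) ⟩
        15 * (p + p)   ≡⟨ double p ⟩
        30 * p         ≤⟨ *-monoˡ-≤ p (m≤m+n 30 13) ⟩
        43 * p         ∎)
        where
        open ≤-Reasoning
        double : ∀ p → 15 * (p + p) ≡ 30 * p
        double = solve-∀
  ... | suc (suc m) , refl = bound (Match⇒Shape p≥1 (s≤s z≤n) M)
        where
        M : Match i (i + p) (suc m)
        M = period⇒Match per
        bound : Shape p (suc m) → RatAtMostC (p + suc (suc m)) p
        bound (even⁺ k p≥ m≤) = even⁺-bound (suc k) p≥ m≤
        bound (odd⁺ k p≥ m≤) = odd⁺-bound (suc k) p≥ m≤
        bound (odd k refl m≤) = odd-bound k m≤
        bound (even (suc k) refl m≤) = even-bound k m≤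
        bound (even zero refl _) = ⊥-elim (no-cube i
          (subst₂ (λ j j′ → S j ≡ S j′) (+-identityʳ i) (trans (cong (_+ 1) (+-identityʳ i)) (+-comm i 1)) (per 0 (s≤s (s≤s z≤n))))
          (subst (λ j → y i ≡ y j) (+-comm i 1) (Match-head M)))

  y-prefix : ∀ r → r < 3 → y r ≡ acb r
  y-prefix r r<3 = trans (cong (λ i → y (i + r)) (sym R-zero)) (y-block 0 r (subst (λ l → r < len l) (sym y0≡a) r<3))

  y1≡c : y 1 ≡ c
  y1≡c = y-prefix 1 (s≤s (s≤s z≤n))

  mis₀ : Mismatch 1 (y 1) (y 2)
  mis₀ = subst₂ (Mismatch 1) (sym y1≡c) (sym (y-prefix 2 ≤-refl)) cb

  -- The adjacent seeds c and b at positions 1 and 2 of the fixed point give the even family: period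
  -- X k, the k-th image length of c. The shift by one is that of `S-suc`.
  long-period : ∀ k → HasPeriod S (suc (R^ k 1)) (X k + overhang 1 0 k) (X k)
  long-period k = X≥1 k , m≤m+n _ _ , λ j j< → trans (S-suc (R^ k 1 + j)) (trans
    (cong twos (trans (match j (+-cancelʳ-< (X k) j (overhang 1 0 k) (subst (j + X k <_) (+-comm (X k) _) j<)))
      (cong y (trans (cong (_+ j) (trans (R^-suc k 1) (cong (λ l → R^ k 1 + weight k l) y1≡c))) (swap (R^ k 1) (X k) j)))))
    (sym (S-suc (R^ k 1 + j + X k))))
    where
    open Canonical (canonical mis₀ k)
    swap : ∀ i p j → i + p + j ≡ i + j + p
    swap = solve-∀

  long-period-beats : ∀ k r s → Balanced (+ X k) (+ Y k) (+ Z k) → 203 * (s * s * s) < X k → RatBelowC r s →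
    ∃[ i ] ∃[ n ] ∃[ p ] (1 ≤ n × MinPeriod S i n p × r * p < n * s)
  long-period-beats k r s B e<X below
    with HasPeriod⇒MinPeriod S (suc (R^ k 1)) (X k + overhang 1 0 k) (long-period k)
  ... | q , q≤p , min = suc (R^ k 1) , X k + overhang 1 0 k , q , ≤-trans (X≥1 k) (m≤m+n _ _) , min ,
    ≤-<-trans (*-monoʳ-≤ r q≤p) (balanced-beats r s B (overhang₁-sum k) e<X below)

  exponent-beats : ∀ r s → RatBelowC r s → ∃[ i ] ∃[ n ] ∃[ p ] (1 ≤ n × MinPeriod S i n p × r * p < n * s)
  -- 9 is where `balanced-even` starts, and X (9 + e) = Z (8 + e) exceeds e.
  exponent-beats r s = long-period-beats (9 + e) r s (balanced-even e) (≤-<-trans (m≤n+m e 8) (k<Z (8 + e)))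
    where
    e = 203 * (s * s * s)

theorem39 : (H S : ℕ → ℕ) → H 0 ≡ 0
    → (∀ i → H (suc i) ≡ suc i ∸ H (H (H i)))
    → (∀ i → ∃[ N ] ((∀ k → H k ≡ i → k < N) × S i ≡ countBelow H i N))
    → (∀ i n p → 1 ≤ n → MinPeriod S i n p → RatAtMostC n p)
      × (∀ a b → 1 ≤ b → RatBelowC a b
          → ∃[ i ] ∃[ n ] ∃[ p ] (1 ≤ n × MinPeriod S i n p × a * p < n * b))
theorem39 H S H-zero H-suc S-count = (λ i n p _ min → exponent≤c i n p (proj₁ min)) , λ a b _ → exponent-beats a b
  where
  open Hofstadter H H-zero H-suc
  open Coding y R R-zero R-suc y-block S (S-zero S S-count) (S-suc S S-count)
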